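{- Let $G$ be a tree with vertex set $\{v_1,\dots,v_n\}$ and diameter at least three. Then there are no graphs $H_1,\dots,H_n$ such that the blow-up $G[H_1,\dots,H_n]$ is betweenness-uniform.
   Context: All graphs are finite and simple; each $H_i$ has at least one vertex. For a graph $G=(V,E)$ and $x\in V$, the betweenness centrality of $x$ is $B(x)=\sum_{\{u,v\}\subseteq V\setminus\{x\},\,u\neq v}\frac{\sigma_{u,v}(x)}{\sigma_{u,v}}$, where $\sigma_{u,v}$ is the number of shortest $uv$-paths and $\sigma_{u,v}(x)$ is the number of those passing through $x$. A graph is betweenness-uniform if $B(x)$ takes the same value for all its vertices. For a graph $G$ on vertex set $\{v_1,\dots,v_n\}$ and graphs $H_1,\dots,H_n$ (with pairwise disjoint vertex sets), the blow-up $G[H_1,\dots,H_n]$ is the graph with vertex set $\bigcup_{i=1}^n V(H_i)$ and edge set $\bigcup_{i=1}^n E(H_i)\cup\{uv : u\in V(H_i), v\in V(H_j), v_iv_j\in E(G)\}$. The diameter of a graph is the maximum distance between two of its vertices. -}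

module Defs where

open import Data.Nat using (ℕ; zero; suc; _≤_; _<_)
open import Data.Bool using (Bool; true; false; T; if_then_else_)
open import Data.Fin using (Fin; toℕ)
open import Data.Fin.Properties using () renaming (_≟_ to _≟ᶠ_)
open import Data.List using (List; []; _∷_; map; concatMap; filter; length; upTo; allFin; _++_; foldr)
open import Data.Bool.ListAction using (any)
open import Data.Empty using (⊥)
open import Data.List.Relation.Unary.Linked using (Linked)
open import Data.List.Relation.Unary.Unique.Propositional using (Unique)
open import Data.Product using (Σ; _×_; _,_; ∃-syntax)
open import Data.Product.Properties using (≡-dec)
open import Data.Integer using (+_)
open import Data.Rational using (ℚ; 0ℚ; _/_) renaming (_+_ to _+ℚ_)
open import Relation.Binary.PropositionalEquality using (_≡_; refl)
open import Relation.Binary.Definitions using (DecidableEquality)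
open import Relation.Nullary using (¬_; does; yes; no)
open import Relation.Nullary.Decidable using (¬?)

record Graph (n : ℕ) : Set where
  field
    adj    : Fin n → Fin n → Bool
    sym    : ∀ u v → adj u v ≡ adj v u
    irrefl : ∀ u → adj u u ≡ false

lastOf : {A : Set} → A → List A → A
lastOf a []       = a
lastOf a (b ∷ bs) = lastOf b bs

module _ {n : ℕ} (G : Graph n) where
  open Graph G

  Adj : Fin n → Fin n → Set
  Adj u v = T (adj u v)

  -- a walk  u = w₀, w₁, …, w_k = v  is represented by  u ∷ ws  with
  -- consecutive vertices adjacent; its length (number of edges) is  length ws
  IsWalk : Fin n → List (Fin n) → Fin n → Set
  IsWalk u ws v = Linked Adj (u ∷ ws) × lastOf u ws ≡ v

  Connected : Set
  Connected = ∀ u v → ∃[ ws ] IsWalk u ws v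

  IsCycle : List (Fin n) → Set
  IsCycle []       = ⊥
  IsCycle (c ∷ cs) = 3 ≤ length (c ∷ cs) × Unique (c ∷ cs)
                     × Linked Adj (c ∷ cs) × Adj (lastOf c cs) c

  IsTree : Set
  IsTree = Connected × (∀ cs → ¬ IsCycle cs)

  -- diam G ≥ 3  iff  some pair u, v has d(u,v) ≥ 3, i.e. every uv-walk
  -- has at least 3 edges
  DiameterAtLeast3 : Set
  DiameterAtLeast3 = ∃[ u ] ∃[ v ] (∀ ws → IsWalk u ws v → 3 ≤ length ws)

-- Betweenness centrality for a finite graph given by an explicit
-- duplicate-free complete list of its vertices

record FinGraph : Set₁ where
  field
    V    : Set
    vs   : List V                -- all vertices, each exactly once
    _≟_  : DecidableEquality V
    adj  : V → V → Bool

module Betweenness (F : FinGraph) where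
  open FinGraph F

  walks : ℕ → V → List (List V)
  walks zero    u = (u ∷ []) ∷ []
  walks (suc k) u = concatMap (λ w → map (u ∷_) (walks k w)) (filter (λ w → Data.Bool.T? (adj u w)) vs)
    where import Data.Bool

  endsAt : V → List V → Bool
  endsAt v []       = false
  endsAt v (a ∷ as) = does (lastOf a as ≟ v)

  uvWalks : ℕ → V → V → List (List V)
  uvWalks k u v = filter (λ p → Data.Bool.T? (endsAt v p)) (walks k u)
    where import Data.Bool

  firstNonEmpty : {A : Set} → List (List A) → List A
  firstNonEmpty []             = []
  firstNonEmpty ([] ∷ ls)      = firstNonEmpty ls
  firstNonEmpty ((a ∷ l) ∷ ls) = a ∷ l

  -- the shortest uv-walks (= shortest uv-paths); a shortest path has fewer
  -- than |V| edges, so it suffices to search lengths 0 … |V|-1.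
  -- Empty iff u, v lie in different components.
  shortestPaths : V → V → List (List V)
  shortestPaths u v = firstNonEmpty (map (λ k → uvWalks k u v) (upTo (length vs)))

  σ : V → V → ℕ
  σ u v = length (shortestPaths u v)

  σ-via : V → V → V → ℕ
  σ-via u v x = length (filter (λ p → Data.Bool.T? (any (λ y → does (x ≟ y)) p)) (shortestPaths u v))
    where import Data.Bool

  -- a / b, with the convention  a / 0 = 0  (only arises for disconnected u, v)
  frac : ℕ → ℕ → ℚ
  frac a zero    = 0ℚ
  frac a (suc b) = (+ a) / suc b

  -- unordered pairs {u, v}, u ≠ v, of elements of a duplicate-free list
  pairs : List V → List (V × V)
  pairs []       = []
  pairs (a ∷ as) = map (a ,_) as ++ pairs as

  avoiding : V → List (V × V)
  avoiding x = filter (λ { (u , v) → Data.Bool.T? (Data.Bool.not (does (u ≟ x)) Data.Bool.∧ Data.Bool.not (does (v ≟ x))) }) (pairs vs)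
    where import Data.Bool

  B : V → ℚ
  B x = foldr (λ { (u , v) acc → frac (σ-via u v x) (σ u v) +ℚ acc }) 0ℚ (avoiding x)

  BetweennessUniform : Set
  BetweennessUniform = ∀ x y → B x ≡ B y

-- The blow-up G[H₁,…,Hₙ]; H i has vertex set Fin (suc (m i)) (nonempty)

module _ {n : ℕ} (G : Graph n) (m : Fin n → ℕ) (H : (i : Fin n) → Graph (suc (m i))) where

  BV : Set
  BV = Σ (Fin n) (λ i → Fin (suc (m i)))

  blowAdj : BV → BV → Bool
  blowAdj (i , a) (j , b) with i ≟ᶠ j
  ... | yes refl = Graph.adj (H i) a b
  ... | no _     = Graph.adj G i j

  blowUp : FinGraph
  blowUp = record
    { V   = BV
    ; vs  = concatMap (λ i → map (i ,_) (allFin (suc (m i)))) (allFin n)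
    ; _≟_ = ≡-dec _≟ᶠ_ _≟ᶠ_
    ; adj = blowAdj
    }

BetweennessUniform : FinGraph → Set
BetweennessUniform F = Betweenness.BetweennessUniform F

{-# OPTIONS --safe #-}
module Submission where

-- Call V(H i) class i.  Write h i for its size (`size`), S i for the sum of
-- 1 / σ u v over its nonadjacent pairs u, v (`classWeight`), and β for the common
-- betweenness.  Let l be a leaf of the tree with neighbour s.  A vertex of class l lies only on
-- shortest paths between nonadjacent vertices of class l or of class s, whence
--   β ≤ S l + S s   and, summing over the class,   h l * β < h l * h l + h l * S s.
-- Conversely, a class i serves as common neighbourhood for each neighbouring
-- class, and every path between classes p and q separated by i meets it, so
--   h i * (S a + S b) + h p * h q ≤ h i * β   for distinct neighbours a, b of i.
-- On a path l, s, t, … with i = s, respectively i = t, these give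
--   h s * S t + h l * h t ≤ h s * S s,   h q < h t,   S b < h l,
-- where b follows t and q is any vertex beyond t.  Apply them from both ends of a
-- path l, s, …, s′, l′ between two leaves, which exists with at least four
-- vertices.  With four vertices S s′ < S s and S s < S s′; with five, h l < h l′
-- and h l′ < h l; with more, the third vertices t, t′ from the two ends satisfy
-- h t′ < h t and h t < h t′.

open import Defs
open import Data.Bool as Bool using (Bool; true; false; T; not; _∧_)
open import Data.Bool.ListAction using (any)
open import Data.Empty using (⊥; ⊥-elim)
open import Data.Fin using (Fin; zero)
import Data.Fin.Properties as Fin
import Data.Integer as ℤ
import Data.Integer.Properties as ℤ
open import Data.List using (List; []; _∷_; map; length; filter; foldr; reverse; _++_; _ʳ++_; applyUpTo; allFin)
import Data.List.Properties as List
open import Data.List.Membership.DecPropositional using (_∈?_)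
open import Data.List.Membership.Propositional using (_∈_; _∉_; find; lose)
import Data.List.Membership.Propositional.Properties as ∈
open import Data.List.Relation.Binary.Permutation.Propositional using (↭-sym; ↭⇒↭ₛ)
open import Data.List.Relation.Binary.Permutation.Propositional.Properties using (↭-reverse)
import Data.List.Relation.Binary.Permutation.Setoid.Properties as Perm
open import Data.List.Relation.Binary.Subset.Propositional using (_⊆_)
open import Data.List.Relation.Binary.Subset.Propositional.Properties using (∈-∷⁺ʳ)
open import Data.List.Relation.Unary.All as All using (All; []; _∷_)
import Data.List.Relation.Unary.All.Properties as All
open import Data.List.Relation.Unary.AllPairs as AllPairs using (AllPairs; []; _∷_)
import Data.List.Relation.Unary.AllPairs.Properties as AllPairs
open import Data.List.Relation.Unary.Any as Any using (here; there)
import Data.List.Relation.Unary.Any.Properties as Any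
open import Data.List.Relation.Unary.Linked as Linked using (Linked; [-]; _∷_)
open import Data.List.Relation.Unary.Unique.Propositional using (Unique)
import Data.List.Relation.Unary.Unique.Propositional.Properties as Unique
open import Data.Nat as ℕ using (ℕ; zero; suc; z≤n; s≤s)
import Data.Nat.Properties as ℕ
open import Data.Product using (Σ; _×_; _,_; proj₁; proj₂; ∃-syntax)
open import Data.Rational as ℚ using (ℚ; 0ℚ; 1ℚ; _+_; _*_; _≤_; _<_; toℚᵘ)
open import Data.Rational.Properties hiding (_≟_)
open import Data.Rational.Solver using (module +-*-Solver)
import Data.Rational.Unnormalised as ℚᵘ
import Data.Rational.Unnormalised.Properties as ℚᵘ
open import Data.Sum using (_⊎_; inj₁; inj₂)
open import Function using (_∘_)
open import Relation.Binary.Construct.Closure.ReflexiveTransitive as Star using (Star; ε; _◅_; _◅◅_)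
open import Relation.Binary.Definitions using (DecidableEquality)
open import Relation.Binary.PropositionalEquality
open import Relation.Nullary using (¬_; Dec; yes; no; does)
open import Relation.Nullary.Decidable using (_×-dec_; ¬?; decidable-stable)
open import Relation.Unary using (Decidable)
open +-*-Solver using (solve; _:=_; _:+_; _:*_)

-- Order arithmetic of rationals.

0≤1 : 0ℚ ≤ 1ℚ
0≤1 = ≤ᵇ⇒≤ _

0<1 : 0ℚ < 1ℚ
0<1 = positive⁻¹ 1ℚ

0≤p*q : ∀ {p q} → 0ℚ ≤ p → 0ℚ ≤ q → 0ℚ ≤ p * q
0≤p*q {p} {q} 0≤p 0≤q = nonNegative⁻¹ (p * q)
  where instance
    _ = ℚ.nonNegative 0≤p
    _ = ℚ.nonNegative 0≤q
    _ = nonNeg*nonNeg⇒nonNeg p q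

*-monoˡ : ∀ {r p q} → 0ℚ ≤ r → p ≤ q → r * p ≤ r * q
*-monoˡ {r} 0≤r = *-monoˡ-≤-nonNeg r {{ℚ.nonNegative 0≤r}}

*-monoʳ : ∀ {r p q} → 0ℚ ≤ r → p ≤ q → p * r ≤ q * r
*-monoʳ {r} 0≤r = *-monoʳ-≤-nonNeg r {{ℚ.nonNegative 0≤r}}

0≤p+q : ∀ {p q} → 0ℚ ≤ p → 0ℚ ≤ q → 0ℚ ≤ p + q
0≤p+q = +-mono-≤

p≤p+q : ∀ {p q} → 0ℚ ≤ q → p ≤ p + q
p≤p+q {p} {q} 0≤q = subst (_≤ p + q) (+-identityʳ p) (+-monoʳ-≤ p 0≤q)

q≤p+q : ∀ {p q} → 0ℚ ≤ p → q ≤ p + q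
q≤p+q {p} {q} 0≤p = subst (_≤ p + q) (+-identityˡ q) (+-monoˡ-≤ q 0≤p)

+-cancelˡ-≤ : ∀ r {p q} → r + p ≤ r + q → p ≤ q
+-cancelˡ-≤ r {p} {q} le = subst₂ _≤_ (shift p) (shift q) (+-monoʳ-≤ (ℚ.- r) le)
  where
  shift : ∀ x → ℚ.- r + (r + x) ≡ x
  shift x = trans (sym (+-assoc (ℚ.- r) r x)) (trans (cong (_+ x) (+-inverseˡ r)) (+-identityˡ x))

+-cancelˡ-< : ∀ r {p q} → r + p < r + q → p < q
+-cancelˡ-< r {p} {q} lt = subst₂ _<_ (shift p) (shift q) (+-monoʳ-< (ℚ.- r) lt)
  where
  shift : ∀ x → ℚ.- r + (r + x) ≡ x
  shift x = trans (sym (+-assoc (ℚ.- r) r x)) (trans (cong (_+ x) (+-inverseˡ r)) (+-identityˡ x))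

*-cancelˡ-< : ∀ {r p q} → 0ℚ ≤ r → r * p < r * q → p < q
*-cancelˡ-< {r} 0≤r = *-cancelˡ-<-nonNeg r {{ℚ.nonNegative 0≤r}}

*-monoˡ-< : ∀ {r p q} → 0ℚ < r → p < q → r * p < r * q
*-monoˡ-< {r} 0<r = *-monoʳ-<-pos r {{ℚ.positive 0<r}}

-- Finite sums and indicators

∑ : {A : Set} → (A → ℚ) → List A → ℚ
∑ f = foldr (λ x acc → f x + acc) 0ℚ

⟦_⟧ : Bool → ℚ
⟦ true ⟧  = 1ℚ
⟦ false ⟧ = 0ℚ

ind : {P : Set} → Dec P → ℚ
ind d = ⟦ does d ⟧

0≤ind : {P : Set} (d : Dec P) → 0ℚ ≤ ind d
0≤ind (yes _) = 0≤1
0≤ind (no _)  = ≤-refl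

ind-yes : {P : Set} (d : Dec P) → P → ind d ≡ 1ℚ
ind-yes (yes _) p = refl
ind-yes (no ¬p) p = ⊥-elim (¬p p)

ind-no : {P : Set} (d : Dec P) → ¬ P → ind d ≡ 0ℚ
ind-no (yes p) ¬p = ⊥-elim (¬p p)
ind-no (no _)  ¬p = refl

ind-mono : {P Q : Set} (d : Dec P) (e : Dec Q) → (P → Q) → ind d ≤ ind e
ind-mono (yes p) e f = ≤-reflexive (sym (ind-yes e (f p)))
ind-mono (no _)  e f = 0≤ind e

module _ {A : Set} where

  ∑-cong : ∀ {f g : A → ℚ} xs → (∀ x → f x ≡ g x) → ∑ f xs ≡ ∑ g xs
  ∑-cong []       eq = refl
  ∑-cong (x ∷ xs) eq = cong₂ _+_ (eq x) (∑-cong xs eq)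

  ∑-mono-All : ∀ {f g : A → ℚ} {xs} → All (λ x → f x ≤ g x) xs → ∑ f xs ≤ ∑ g xs
  ∑-mono-All []       = ≤-refl
  ∑-mono-All (p ∷ ps) = +-mono-≤ p (∑-mono-All ps)

  ∑-mono : ∀ {f g : A → ℚ} xs → (∀ x → f x ≤ g x) → ∑ f xs ≤ ∑ g xs
  ∑-mono xs le = ∑-mono-All (All.universal le xs)

  ∑-0 : (xs : List A) → ∑ (λ _ → 0ℚ) xs ≡ 0ℚ
  ∑-0 []       = refl
  ∑-0 (x ∷ xs) = trans (+-identityˡ _) (∑-0 xs)

  0≤∑ : ∀ {f : A → ℚ} xs → (∀ x → 0ℚ ≤ f x) → 0ℚ ≤ ∑ f xs
  0≤∑ {f} xs le = subst (_≤ ∑ f xs) (∑-0 xs) (∑-mono xs le)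

  ∑-+ : ∀ (f g : A → ℚ) xs → ∑ (λ x → f x + g x) xs ≡ ∑ f xs + ∑ g xs
  ∑-+ f g []       = refl
  ∑-+ f g (x ∷ xs) = trans (cong ((f x + g x) +_) (∑-+ f g xs))
                           (solve 4 (λ a b c d → (a :+ b) :+ (c :+ d) := (a :+ c) :+ (b :+ d)) refl
                             (f x) (g x) (∑ f xs) (∑ g xs))

  ∑-*ˡ : ∀ c (f : A → ℚ) xs → ∑ (λ x → c * f x) xs ≡ c * ∑ f xs
  ∑-*ˡ c f []       = sym (*-zeroʳ c)
  ∑-*ˡ c f (x ∷ xs) = trans (cong (c * f x +_) (∑-*ˡ c f xs))
                            (sym (*-distribˡ-+ c (f x) (∑ f xs)))

  ∑-*ʳ : ∀ c (f : A → ℚ) xs → ∑ (λ x → f x * c) xs ≡ ∑ f xs * c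
  ∑-*ʳ c f xs = trans (∑-cong xs (λ x → *-comm (f x) c))
                      (trans (∑-*ˡ c f xs) (*-comm c (∑ f xs)))

  ∑-++ : ∀ (f : A → ℚ) xs ys → ∑ f (xs ++ ys) ≡ ∑ f xs + ∑ f ys
  ∑-++ f []       ys = sym (+-identityˡ _)
  ∑-++ f (x ∷ xs) ys = trans (cong (f x +_) (∑-++ f xs ys)) (sym (+-assoc (f x) _ _))

  ∑-filter : {P : A → Set} (P? : Decidable P) (f : A → ℚ) (xs : List A) →
             ∑ f (filter P? xs) ≡ ∑ (λ x → ind (P? x) * f x) xs
  ∑-filter P? f []       = refl
  ∑-filter P? f (x ∷ xs) with does (P? x)
  ... | true  = cong₂ _+_ (sym (*-identityˡ (f x))) (∑-filter P? f xs)
  ... | false = trans (∑-filter P? f xs)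
                      (sym (trans (cong (_+ ∑ (λ y → ind (P? y) * f y) xs) (*-zeroˡ (f x)))
                      (+-identityˡ _)))

  ∈⇒≤∑ : ∀ {f : A → ℚ} {x xs} → (∀ y → 0ℚ ≤ f y) → x ∈ xs → f x ≤ ∑ f xs
  ∈⇒≤∑ {xs = _ ∷ xs} 0≤f (here refl) = p≤p+q (0≤∑ xs 0≤f)
  ∈⇒≤∑ {xs = y ∷ _}  0≤f (there x∈)  = ≤-trans (∈⇒≤∑ 0≤f x∈) (q≤p+q (0≤f y))

  ∑-ind-≤1 : (_≟_ : DecidableEquality A) (z : A) {xs : List A} → Unique xs →
             ∑ (λ x → ind (x ≟ z)) xs ≤ 1ℚ
  ∑-ind-≤1 _≟_ z {[]} [] = 0≤1
  ∑-ind-≤1 _≟_ z {x ∷ xs} (x∉ ∷ uniq) with x ≟ z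
  ... | no _     = ≤-trans (≤-reflexive (+-identityˡ _)) (∑-ind-≤1 _≟_ z uniq)
  ... | yes refl = ≤-reflexive (trans (cong (1ℚ +_)
                     (rest-0 xs (Unique.Unique[x∷xs]⇒x∉xs (x∉ ∷ uniq)))) (+-identityʳ 1ℚ))
    where
    rest-0 : ∀ ys → z ∉ ys → ∑ (λ y → ind (y ≟ z)) ys ≡ 0ℚ
    rest-0 []       z∉ = refl
    rest-0 (y ∷ ys) z∉ = trans
      (cong₂ _+_ (ind-no (y ≟ z) (λ y≡z → z∉ (here (sym y≡z)))) (rest-0 ys (z∉ ∘ there)))
      (+-identityˡ 0ℚ)

∑-map : {A B : Set} (f : B → ℚ) (g : A → B) (xs : List A) → ∑ f (map g xs) ≡ ∑ (f ∘ g) xs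
∑-map f g []       = refl
∑-map f g (x ∷ xs) = cong (f (g x) +_) (∑-map f g xs)

∑-swap : {A B : Set} (f : A → B → ℚ) (xs : List A) (ys : List B) →
         ∑ (λ x → ∑ (f x) ys) xs ≡ ∑ (λ y → ∑ (λ x → f x y) xs) ys
∑-swap f []       ys = sym (∑-0 ys)
∑-swap f (x ∷ xs) ys = trans (cong (∑ (f x) ys +_) (∑-swap f xs ys))
                             (sym (∑-+ (f x) (λ y → ∑ (λ x′ → f x′ y) xs) ys))

-- Fractions and sums over unordered pairs

module _ (F : FinGraph) where
  open FinGraph F using (V)
  open Betweenness F

  frac-0 : ∀ b → frac 0 b ≡ 0ℚ
  frac-0 zero    = refl
  frac-0 (suc b) = 0/n≡0 (suc b)

  toℚᵘ-frac : ∀ a b → toℚᵘ (frac a (suc b)) ℚᵘ.≃ ℚᵘ.mkℚᵘ (ℤ.+ a) b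
  toℚᵘ-frac a b = toℚᵘ-fromℚᵘ (ℚᵘ.mkℚᵘ (ℤ.+ a) b)

  -- Splitting off one unit at a time turns `σ-via` over `σ` into a sum of 1 / `σ` over paths, which
  -- can be exchanged with sums over vertices. For denominator zero both sides are 0 by convention.
  frac-suc : ∀ a b → frac (suc a) b ≡ frac 1 b + frac a b
  frac-suc a zero    = refl
  frac-suc a (suc b) = toℚᵘ-injective (begin
    toℚᵘ (frac (suc a) (suc b))                       ≈⟨ toℚᵘ-frac (suc a) b ⟩
    ℚᵘ.mkℚᵘ (ℤ.+ suc a) b                               ≈⟨ same-denominator ⟩
    ℚᵘ.mkℚᵘ (ℤ.+ 1) b ℚᵘ.+ ℚᵘ.mkℚᵘ (ℤ.+ a) b              ≈⟨ ℚᵘ.+-cong (toℚᵘ-frac 1 b) (toℚᵘ-frac a b) ⟨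
    toℚᵘ (frac 1 (suc b)) ℚᵘ.+ toℚᵘ (frac a (suc b))  ≈⟨ toℚᵘ-homo-+ (frac 1 (suc b)) (frac a (suc b)) ⟨
    toℚᵘ (frac 1 (suc b) + frac a (suc b))            ∎)
    where
    open ℚᵘ.≃-Reasoning
    d = ℤ.+ suc b
    same-denominator : ℚᵘ.mkℚᵘ (ℤ.+ suc a) b ℚᵘ.≃ ℚᵘ.mkℚᵘ (ℤ.+ 1) b ℚᵘ.+ ℚᵘ.mkℚᵘ (ℤ.+ a) b
    same-denominator = ℚᵘ.*≡* (trans (cong ((ℤ.+ suc a) ℤ.*_) (ℤ.pos-* (suc b) (suc b)))
      (trans (sym (ℤ.*-assoc (ℤ.+ suc a) d d))
      (cong (ℤ._* d) (ℤ.*-distribʳ-+ d (ℤ.+ 1) (ℤ.+ a)))))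

  frac-n-n : ∀ {b} → 0 ℕ.< b → frac b b ≡ 1ℚ
  frac-n-n {suc b} _ = toℚᵘ-injective (ℚᵘ.≃-trans (toℚᵘ-frac (suc b) b)
    (ℚᵘ.*≡* (ℤ.*-comm (ℤ.+ suc b) (ℤ.+ 1))))

  0≤frac-1 : ∀ b → 0ℚ ≤ frac 1 b
  0≤frac-1 zero    = ≤-refl
  0≤frac-1 (suc b) = nonNegative⁻¹ (frac 1 (suc b)) {{normalize-nonNeg 1 (suc b)}}

  frac-filter : {A : Set} {P : A → Set} (P? : Decidable P) (xs : List A) (b : ℕ) →
                frac (length (filter P? xs)) b ≡ ∑ (λ x → ind (P? x) * frac 1 b) xs
  frac-filter P? []       b = frac-0 b
  frac-filter P? (x ∷ xs) b with does (P? x)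
  ... | true  = trans (frac-suc (length (filter P? xs)) b)
                      (cong₂ _+_ (sym (*-identityˡ (frac 1 b))) (frac-filter P? xs b))
  ... | false = trans (frac-filter P? xs b)
                      (sym (trans (cong (_+ ∑ (λ y → ind (P? y) * frac 1 b) xs) (*-zeroˡ (frac 1 b)))
                      (+-identityˡ _)))

  frac-length : {A : Set} (xs : List A) (b : ℕ) → frac (length xs) b ≡ ∑ (λ _ → frac 1 b) xs
  frac-length []       b = frac-0 b
  frac-length (x ∷ xs) b = trans (frac-suc (length xs) b) (cong (frac 1 b +_) (frac-length xs b))

  -- `pairs` lists each unordered pair in one order only, so both orders and the diagonal are needed
  -- to fill the square. In the induction the new element adds a row, a column and one diagonal
  -- entry.
  ∑-pairs : (K : V → V → ℚ) (xs : List V) →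
    ∑ (λ p → K (proj₁ p) (proj₂ p) + K (proj₂ p) (proj₁ p)) (pairs xs) + ∑ (λ u → K u u) xs ≡
    ∑ (λ u → ∑ (K u) xs) xs
  ∑-pairs K []       = refl
  ∑-pairs K (a ∷ as) = begin
    ∑ K² (map (a ,_) as ++ pairs as) + (K a a + ∑ Kᵈ as)
      ≡⟨ cong (_+ (K a a + ∑ Kᵈ as)) (trans (∑-++ K² (map (a ,_) as) (pairs as))
           (cong (_+ ∑ K² (pairs as)) (trans (∑-map K² (a ,_) as) (∑-+ (K a) (λ u → K u a) as)))) ⟩
    ((row + column) + ∑ K² (pairs as)) + (K a a + ∑ Kᵈ as)
      ≡⟨ solve 5 (λ r c p k d → ((r :+ c) :+ p) :+ (k :+ d) := (k :+ r) :+ (c :+ (p :+ d))) refl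
           row column (∑ K² (pairs as)) (K a a) (∑ Kᵈ as) ⟩
    (K a a + row) + (column + (∑ K² (pairs as) + ∑ Kᵈ as))
      ≡⟨ cong (λ z → (K a a + row) + (column + z)) (∑-pairs K as) ⟩
    (K a a + row) + (column + ∑ (λ u → ∑ (K u) as) as)
      ≡⟨ cong ((K a a + row) +_) (sym (∑-+ (λ u → K u a) (λ u → ∑ (K u) as) as)) ⟩
    (K a a + row) + ∑ (λ u → K u a + ∑ (K u) as) as  ∎
    where
    open ≡-Reasoning
    K² : V × V → ℚ
    K² p = K (proj₁ p) (proj₂ p) + K (proj₂ p) (proj₁ p)
    Kᵈ : V → ℚ
    Kᵈ u = K u u
    row    = ∑ (K a) as
    column = ∑ (λ u → K u a) as

  All-pairs : {R : V → V → Set} {xs : List V} → AllPairs R xs →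
              All (λ p → R (proj₁ p) (proj₂ p)) (pairs xs)
  All-pairs []         = []
  All-pairs (rs ∷ rss) = All.++⁺ (All.map⁺ rs) (All-pairs rss)

-- Duplicate-free lists, linked lists and reversal.

∉⇒All≢ : {A : Set} {x : A} {xs : List A} → x ∉ xs → All (x ≢_) xs
∉⇒All≢ = All.¬Any⇒All¬ _

lastOf-∈ : {A : Set} (x : A) (xs : List A) → lastOf x xs ∈ x ∷ xs
lastOf-∈ x []       = here refl
lastOf-∈ x (y ∷ xs) = there (lastOf-∈ y xs)

-- Pigeonhole: the head is cut out of `ys`, and uniqueness keeps the tail inside what remains.
Unique-⊆⇒length≤ : {A : Set} {xs ys : List A} → Unique xs → xs ⊆ ys →
                   length xs ℕ.≤ length ys
Unique-⊆⇒length≤ {xs = []}     _  _ = z≤n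
Unique-⊆⇒length≤ {xs = x ∷ xs} (x≢ ∷ uniq) xs⊆ys with ∈.∈-∃++ (xs⊆ys (here refl))
... | as , bs , refl = subst (suc (length xs) ℕ.≤_) (sym length-split)
                         (s≤s (Unique-⊆⇒length≤ uniq tail⊆))
  where
  length-split : length (as ++ x ∷ bs) ≡ suc (length (as ++ bs))
  length-split = trans (List.length-++ as)
    (trans (ℕ.+-suc (length as) (length bs)) (cong suc (sym (List.length-++ as))))
  tail⊆ : xs ⊆ as ++ bs
  tail⊆ y∈ with ∈.∈-++⁻ as (xs⊆ys (there y∈))
  ... | inj₁ y∈as          = ∈.∈-++⁺ˡ y∈as
  ... | inj₂ (here refl)   = ⊥-elim (All.lookup x≢ y∈ refl)
  ... | inj₂ (there y∈bs)  = ∈.∈-++⁺ʳ as y∈bs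

Unique-reverse : {A : Set} {xs : List A} → Unique xs → Unique (reverse xs)
Unique-reverse {A} {xs} = Perm.Unique-resp-↭ (setoid A) (↭⇒↭ₛ (↭-sym (↭-reverse xs)))

Linked-ʳ++ : {A : Set} {R : A → A → Set} (R-sym : ∀ {x y} → R x y → R y x) →
             ∀ {x xs ys} → Linked R (x ∷ xs) → Linked R (x ∷ ys) → Linked R (xs ʳ++ (x ∷ ys))
Linked-ʳ++ R-sym [-]      l = l
Linked-ʳ++ R-sym (r ∷ rs) l = Linked-ʳ++ R-sym rs (R-sym r ∷ l)

-- Puts a reversed list into the head-and-tail form that `extend` takes, keeping track of both ends.
reverse-last : {A : Set} (x : A) (xs ys : List A) →
               ∃[ zs ] xs ʳ++ (x ∷ ys) ≡ lastOf x xs ∷ zs × lastOf (lastOf x xs) zs ≡ lastOf x ys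
reverse-last x []        ys = ys , refl , refl
reverse-last x (x′ ∷ xs) ys = reverse-last x′ xs (x ∷ ys)

lastThree : {A : Set} (x y z : A) (xs : List A) →
            ∃[ ys ] ∃[ d ] ∃[ e ] ∃[ f ] x ∷ y ∷ z ∷ xs ≡ ys ++ d ∷ e ∷ f ∷ []
lastThree x y z []       = [] , x , y , z , refl
lastThree x y z (w ∷ xs) = let ys , d , e , f , eq = lastThree y z w xs in
  x ∷ ys , d , e , f , cong (x ∷_) eq

-- Paths in trees

module Paths {n : ℕ} (G : Graph n) where
  open Graph G using (adj; irrefl)

  adj-sym : ∀ {u v} → Adj G u v → Adj G v u
  adj-sym {u} {v} = subst T (Graph.sym G u v)

  ¬adj-refl : ∀ {u} → ¬ Adj G u u
  ¬adj-refl {u} = subst T (irrefl u)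

  IsPath : List (Fin n) → Set
  IsPath P = Linked (Adj G) P × Unique P

  -- The bound `S` makes it possible to conclude that a vertex outside it is off the path.
  PathWithin : Fin n → Fin n → List (Fin n) → Set
  PathWithin u v S = ∃[ P ] IsPath (u ∷ P) × lastOf u P ≡ v × u ∷ P ⊆ S

  path-tail : ∀ {x P} → IsPath (x ∷ P) → IsPath P
  path-tail (l , _ ∷ u) = Linked.tail l , u

  reverse-path : ∀ {P} → IsPath P → IsPath (reverse P)
  reverse-path {[]}    p       = p
  reverse-path {x ∷ P} (l , u) = Linked-ʳ++ adj-sym l [-] , Unique-reverse u

  suffix : ∀ {x} c P → IsPath (c ∷ P) → x ∈ c ∷ P → PathWithin x (lastOf c P) (c ∷ P)
  suffix c P       p (here refl) = P , p , refl , λ y∈ → y∈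
  suffix c (d ∷ P) p (there x∈)  =
    let Q , q , last , Q⊆ = suffix d P (path-tail p) x∈ in Q , q , last , there ∘ Q⊆

  -- Moving the start of a path to an adjacent vertex keeps it simple: if the
  -- new start already lies on the path, the part before it is dropped.
  reroot : ∀ {x c P} → IsPath (c ∷ P) → Adj G x c → PathWithin x (lastOf c P) (x ∷ c ∷ P)
  reroot {x} {c} {P} p@(l , u) x~c with _∈?_ Fin._≟_ x (c ∷ P)
  ... | no x∉ = c ∷ P , (x~c ∷ l , ∉⇒All≢ x∉ ∷ u) , refl , λ y∈ → y∈
  ... | yes x∈ = let Q , q , last , Q⊆ = suffix c P p x∈ in Q , q , last , there ∘ Q⊆

  -- One `reroot` per edge of the walk. Started from a one-vertex path, this extracts a simple path
  -- from a walk, or leads back along a path from any of its vertices.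
  rerootAlong : ∀ {i q S} c R → Linked (Adj G) (c ∷ R) → R ⊆ S →
                PathWithin c i S → q ∈ c ∷ R → PathWithin q i S
  rerootAlong c R       l         R⊆S p (here refl) = p
  rerootAlong {S = S} c (r ∷ R) (c~r ∷ l) R⊆S (P , p , last , P⊆) (there q∈) =
    let Q , q , lastQ , Q⊆ = reroot p (adj-sym c~r)
        Q⊆S : _ ⊆ S
        Q⊆S = λ y∈ → ∈-∷⁺ʳ (R⊆S (here refl)) P⊆ (Q⊆ y∈)
    in rerootAlong r R l (R⊆S ∘ there) (Q , q , trans lastQ last , Q⊆S) q∈

  -- Equal ends are allowed because an edge of the blow-up inside a class projects to a step that
  -- stays in place.
  StepAvoiding : Fin n → Fin n → Fin n → Set
  StepAvoiding i u v = (u ≡ v ⊎ Adj G u v) × u ≢ i × v ≢ i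

  Connects : Fin n → Fin n → Fin n → Set
  Connects i = Star (StepAvoiding i)

  module _ (acyclic : ∀ cs → ¬ IsCycle G cs) where

    -- Carry a simple path ending in t along the walk; when the walk reaches s,
    -- the edge t s closes it to a cycle.
    ¬connects-ends : ∀ {s t c P} → Adj G t s → IsPath (c ∷ P) → lastOf c P ≡ t → s ∉ c ∷ P →
                     ¬ Connects t c s
    ¬connects-ends t~s p last s∉ ε = s∉ (here refl)
    ¬connects-ends t~s p last s∉ ((inj₁ refl , _) ◅ w) = ¬connects-ends t~s p last s∉ w
    ¬connects-ends {s} {t} {c} {P} t~s p last s∉ (_◅_ {j = c′} (inj₂ c~c′ , c≢t , _) w) with c′ Fin.≟ s
    ... | no c′≢s = let Q , q , lastQ , Q⊆ = reroot p (adj-sym c~c′) in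
      ¬connects-ends t~s q (trans lastQ last)
        (λ s∈ → s∉ (Any.tail (c′≢s ∘ sym) (Q⊆ s∈))) w
    ... | yes refl with P
    ...   | []     = c≢t last
    ...   | d ∷ P′ = acyclic (s ∷ c ∷ d ∷ P′)
                       ( s≤s (s≤s (s≤s z≤n)) , ∉⇒All≢ s∉ ∷ proj₂ p
                       , adj-sym c~c′ ∷ proj₁ p , subst (λ z → Adj G z s) (sym last) t~s )

    -- A simple path leads back from `q` to `i` inside `i ∷ R`, hence off `a`. A connection from `q`
    -- to `a` avoiding `i` would close up with the edge between `i` and `a`, against
    -- `¬connects-ends`.
    path-separates : ∀ {a i q R} → IsPath (a ∷ i ∷ R) → q ∈ R → ¬ Connects i q a
    path-separates {a} {i} {q} {R} (a~i ∷ l , a≢ ∷ u) q∈ =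
      let P , p , last , Q⊆ = rerootAlong i R l there
                               ([] , ([-] , [] ∷ []) , refl , λ { (here eq) → here eq }) (there q∈)
      in ¬connects-ends (adj-sym a~i) p last (Unique.Unique[x∷xs]⇒x∉xs (a≢ ∷ u) ∘ Q⊆)

    -- Maximality at the head: no new vertex can be put in front.
    NeighboursOfHeadIn : List (Fin n) → Set
    NeighboursOfHeadIn []      = ⊥
    NeighboursOfHeadIn (c ∷ P) = ∀ x → Adj G c x → x ∈ c ∷ P

    -- A second neighbour of `d` would lie beyond `e` on the path and reach `d` in one step avoiding
    -- `e`, although `e` separates them.
    head-leaf : ∀ {d e P} → IsPath (d ∷ e ∷ P) → NeighboursOfHeadIn (d ∷ e ∷ P) →
                ∀ x → Adj G d x → x ≡ e
    head-leaf p nbrs x d~x with nbrs x d~x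
    ... | here refl         = ⊥-elim (¬adj-refl d~x)
    ... | there (here eq)   = eq
    ... | there (there x∈P) with p
    ...   | _ , (d≢e ∷ _) ∷ (e≢ ∷ _) =
      ⊥-elim (path-separates p x∈P ((inj₂ (adj-sym d~x) , All.lookup e≢ x∈P ∘ sym , d≢e) ◅ ε))

    path-length≤n : ∀ {P} → IsPath P → length P ℕ.≤ n
    path-length≤n {P} (_ , u) = subst (length P ℕ.≤_) (List.length-tabulate (λ i → i))
      (Unique-⊆⇒length≤ u (λ {x} _ → ∈.∈-allFin x))

    -- Greedy prolongation with `k` as fuel: at `zero` the path would have more than `n` vertices.
    extend : ∀ k c P → n ℕ.< k ℕ.+ length (c ∷ P) → IsPath (c ∷ P) →
             ∃[ d ] ∃[ Q ] IsPath (d ∷ Q) × NeighboursOfHeadIn (d ∷ Q)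
               × lastOf d Q ≡ lastOf c P × c ∷ P ⊆ d ∷ Q
    extend zero    c P n< p = ⊥-elim (ℕ.<⇒≱ n< (path-length≤n p))
    extend (suc k) c P n< p
      with Fin.any? (λ x → Bool.T? (adj c x) ×-dec ¬? (_∈?_ Fin._≟_ x (c ∷ P)))
    ... | no none = c , P , p
      , (λ x c~x → decidable-stable (_∈?_ Fin._≟_ x (c ∷ P)) (λ x∉ → none (x , c~x , x∉)))
      , refl , λ y∈ → y∈
    ... | yes (x , c~x , x∉) =
      let d , Q , q , nbrs , last , Q⊆ =
            extend k x (c ∷ P) (subst (n ℕ.<_) (sym (ℕ.+-suc k _)) n<)
              (adj-sym c~x ∷ proj₁ p , ∉⇒All≢ x∉ ∷ proj₂ p)
      in d , Q , q , nbrs , last , Q⊆ ∘ there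

    -- A simple path between two vertices at distance at least three is prolonged at one end,
    -- reversed, and prolonged at the other.
    leaf-to-leaf-path : Connected G → DiameterAtLeast3 G →
      ∃[ P ] IsPath P × 4 ℕ.≤ length P × NeighboursOfHeadIn P × NeighboursOfHeadIn (reverse P)
    leaf-to-leaf-path connected (u , v , far) =
      let ws , l , last = connected v u
          P₀ , p₀ , last₀ , _ = rerootAlong {S = v ∷ ws} v ws l there
            ([] , ([-] , [] ∷ []) , refl , λ { (here eq) → here eq })
            (subst (_∈ v ∷ ws) last (lastOf-∈ v ws))
          d , Q , q , nbrs , _ , P₀⊆ = extend n u P₀ (ℕ.m<m+n n (s≤s z≤n)) p₀
          zs , rev , rev-last = reverse-last d Q []
          p₁ = subst IsPath rev (reverse-path q)
          e , R , r , nbrs′ , last′ , Q⊆ = extend n (lastOf d Q) zs (ℕ.m<m+n n (s≤s z≤n)) p₁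
          zs′ , rev′ , _ = reverse-last e R []
          Q⊆R : d ∷ Q ⊆ e ∷ R
          Q⊆R = λ y∈ → Q⊆ (subst (_ ∈_) rev (Any.reverse⁺ y∈))
          last-is-d = trans last′ rev-last
      in e ∷ R , r
       -- At least three edges mean at least four vertices, and all of them survive both
       -- prolongations.
       , ℕ.≤-trans (s≤s (far P₀ (proj₁ p₀ , last₀)))
           (Unique-⊆⇒length≤ (proj₂ p₀) (Q⊆R ∘ P₀⊆))
       , nbrs′
       -- The second prolongation only adds vertices, so the neighbours of the first end still lie
       -- on the path.
       , subst NeighboursOfHeadIn (sym rev′)
           (λ x a → subst (x ∈_) rev′ (Any.reverse⁺ (Q⊆R (nbrs x (subst (λ z → Adj G z x) last-is-d a)))))

T-does⁻ : {P : Set} (d : Dec P) → T (does d) → P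
T-does⁻ (yes p) _ = p

T-does⁺ : {P : Set} (d : Dec P) → P → T (does d)
T-does⁺ (yes _) _ = _
T-does⁺ (no ¬p) p = ¬p p

-- Shortest paths

module Walks (F : FinGraph) where
  open FinGraph F
  open Betweenness F

  data Walk : ℕ → V → V → List V → Set where
    nil  : ∀ {u} → Walk 0 u u (u ∷ [])
    cons : ∀ {k u w v p} → T (adj u w) → Walk k w v p → Walk (suc k) u v (u ∷ p)

  Reach : ℕ → V → V → Set
  Reach k u v = ∃[ p ] Walk k u v p

  infixr 5 _∙_
  _∙_ : ∀ {j k u w v} → Reach j u w → Reach k w v → Reach (j ℕ.+ k) u v
  (_ , nil)      ∙ r = r
  (_ , cons a w) ∙ r = let _ , w′ = (_ , w) ∙ r in _ , cons a w′

  step : ∀ {u v} → T (adj u v) → Reach 1 u v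
  step a = _ , cons a nil

  split : ∀ {k u v p x} → Walk k u v p → x ∈ p →
          ∃[ i ] ∃[ j ] Reach i u x × Reach j x v × i ℕ.+ j ≡ k
  split nil        (here refl) = 0 , 0 , (_ , nil) , (_ , nil) , refl
  split (cons a w) (here refl) = 0 , _ , (_ , nil) , (_ , cons a w) , refl
  split (cons a w) (there x∈)  = let i , j , (_ , w₁) , r , eq = split w x∈ in
    suc i , j , (_ , cons a w₁) , r , cong suc eq

  unsnoc : ∀ {k u v} → Reach (suc k) u v → ∃[ w ] Reach k u w × T (adj w v)
  unsnoc (_ , cons a nil)        = _ , (_ , nil) , a
  unsnoc (_ , cons a (cons b w)) = let z , (_ , w′) , c = unsnoc (_ , cons b w) in
    z , (_ , cons a w′) , c

  neighbours : V → List V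
  neighbours u = filter (λ w → Bool.T? (adj u w)) vs

  walks-head : ∀ k {u p} → p ∈ walks k u → ∃[ q ] p ≡ u ∷ q
  walks-head zero    (here eq) = [] , eq
  walks-head (suc k) {u} p∈ with Any.satisfied (∈.∈-concatMap⁻ (λ w → map (u ∷_) (walks k w)) {xs = neighbours u} p∈)
  ... | w , p∈map with ∈.∈-map⁻ (u ∷_) p∈map
  ...   | q , _ , eq = q , eq

  walks-sound : ∀ k {u v p} → p ∈ walks k u → T (endsAt v p) → Walk k u v p
  walks-sound zero {u} {v} (here refl) end with T-does⁻ (u ≟ v) end
  ... | refl = nil
  walks-sound (suc k) {u} p∈ end
    with find (∈.∈-concatMap⁻ (λ w → map (u ∷_) (walks k w)) {xs = neighbours u} p∈)
  ... | w , w∈ , p∈map with ∈.∈-map⁻ (u ∷_) p∈map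
  ...   | q , q∈ , refl with walks-head k q∈
  ...     | _ , refl = cons (proj₂ (∈.∈-filter⁻ (λ z → Bool.T? (adj u z)) {xs = vs} w∈)) (walks-sound k q∈ end)

  uvWalks-sound : ∀ k {u v p} → p ∈ uvWalks k u v → Walk k u v p
  uvWalks-sound k {u} {v} p∈ =
    let p∈walks , end = ∈.∈-filter⁻ (λ p → Bool.T? (endsAt v p)) {xs = walks k u} p∈ in walks-sound k p∈walks end

  -- Walks with different first steps differ in their second vertex, so the lists concatenated by
  -- `walks` are disjoint.
  walks-unique : Unique vs → ∀ k u → Unique (walks k u)
  walks-unique uniq zero    u = [] ∷ []
  walks-unique uniq (suc k) u = Unique.concat⁺
    (All.map⁺ (All.universal (λ w → Unique.map⁺ List.∷-injectiveʳ (walks-unique uniq k w)) _))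
    (AllPairs.map⁺ (AllPairs.map disjoint (Unique.filter⁺ (λ z → Bool.T? (adj u z)) uniq)))
    where
    disjoint : ∀ {w w′} → w ≢ w′ → ∀ {p} →
               ¬ (p ∈ map (u ∷_) (walks k w) × p ∈ map (u ∷_) (walks k w′))
    disjoint w≢w′ (p∈ , p∈′) with ∈.∈-map⁻ (u ∷_) p∈ | ∈.∈-map⁻ (u ∷_) p∈′
    ... | q , q∈ , refl | q′ , q∈′ , eq
      with walks-head k q∈ | walks-head k (subst (_∈ _) (sym (List.∷-injectiveʳ eq)) q∈′)
    ...   | _ , eq₁ | _ , eq₂ = w≢w′ (List.∷-injectiveˡ (trans (sym eq₁) eq₂))

  uvWalks-unique : Unique vs → ∀ k u v → Unique (uvWalks k u v)
  uvWalks-unique uniq k u v = Unique.filter⁺ (λ p → Bool.T? (endsAt v p)) (walks-unique uniq k u)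

  firstNonEmpty-spec : {A : Set} (f : ℕ → List A) (N : ℕ) →
    firstNonEmpty (applyUpTo f N) ≡ [] × (∀ {k} → k ℕ.< N → f k ≡ []) ⊎
    ∃[ k ] k ℕ.< N × firstNonEmpty (applyUpTo f N) ≡ f k × f k ≢ [] × (∀ {j} → j ℕ.< k → f j ≡ [])
  firstNonEmpty-spec f zero = inj₁ (refl , λ ())
  firstNonEmpty-spec f (suc N) with f 0 in eq
  ... | a ∷ as = inj₂ (0 , s≤s z≤n , sym eq , (λ f0≡[] → case (trans (sym eq) f0≡[])) , λ ())
    where case : a ∷ as ≢ []
          case ()
  ... | [] with firstNonEmpty-spec (f ∘ suc) N
  ...   | inj₁ (e , all) = inj₁ (e , λ { {zero} _ → eq ; {suc k} (s≤s k<) → all k< })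
  ...   | inj₂ (k , k< , e , ne , below) =
    inj₂ (suc k , s≤s k< , e , ne , λ { {zero} _ → eq ; {suc j} (s≤s j<) → below j< })

  module Complete (complete : ∀ x → x ∈ vs) where

    walk-end : ∀ {k u v p} → Walk k u v p → T (endsAt v p)
    walk-end {u = u} nil               = T-does⁺ (u ≟ u) refl
    walk-end {v = v} (cons a nil)      = T-does⁺ (v ≟ v) refl
    walk-end (cons a w@(cons _ _))     = walk-end w

    walks-complete : ∀ {k u v p} → Walk k u v p → p ∈ walks k u
    walks-complete nil = here refl
    walks-complete {suc k} {u} (cons {w = w} a w′) =
      ∈.∈-concatMap⁺ (λ z → map (u ∷_) (walks k z))
        (lose (∈.∈-filter⁺ (λ z → Bool.T? (adj u z)) (complete w) a)
              (∈.∈-map⁺ (u ∷_) (walks-complete w′)))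

    uvWalks-complete : ∀ {k u v p} → Walk k u v p → p ∈ uvWalks k u v
    uvWalks-complete {v = v} w =
      ∈.∈-filter⁺ (λ p → Bool.T? (endsAt v p)) (walks-complete w) (walk-end w)

    record Shortest (u v : V) : Set where
      field
        dist     : ℕ
        reach    : Reach dist u v
        paths    : shortestPaths u v ≡ uvWalks dist u v
        minimal  : ∀ {j} → j ℕ.< dist → ¬ Reach j u v

    -- The first alternative excludes only walks within the search bound `length vs`. This is why
    -- later lemmas ask for a walk shorter than that bound.
    shortestPaths-spec : ∀ u v → shortestPaths u v ≡ [] × (∀ {k} → k ℕ.< length vs → ¬ Reach k u v) ⊎ Shortest u v
    shortestPaths-spec u v with firstNonEmpty-spec (λ k → uvWalks k u v) (length vs)
                | List.map-upTo (λ k → uvWalks k u v) (length vs)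
    ... | inj₁ (e , none) | m = inj₁ (trans (cong firstNonEmpty m) e ,
                                      λ k< (p , w) → empty (none k<) (uvWalks-complete w))
      where empty : ∀ {p} {ps : List (List V)} → ps ≡ [] → ¬ p ∈ ps
            empty refl ()
    ... | inj₂ (k , k< , e , ne , below) | m = inj₂ (record
      { dist = k ; reach = inhabited (uvWalks k u v) ne (uvWalks-sound k)
      ; paths = trans (cong firstNonEmpty m) e
      ; minimal = λ j< (p , w) → empty (below j<) (uvWalks-complete w) })
      where empty : ∀ {p} {ps : List (List V)} → ps ≡ [] → ¬ p ∈ ps
            empty refl ()
            inhabited : ∀ {Q : List V → Set} (ps : List (List V)) → ps ≢ [] →
                        (∀ {p} → p ∈ ps → Q p) → ∃[ p ] Q p
            inhabited []       ne q = ⊥-elim (ne refl)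
            inhabited (p ∷ ps) ne q = p , q (here refl)

    reach⇒shortest : ∀ {k u v} → k ℕ.< length vs → Reach k u v → Shortest u v
    reach⇒shortest {u = u} {v} k< r with shortestPaths-spec u v
    ... | inj₁ (_ , none) = ⊥-elim (none k< r)
    ... | inj₂ s          = s

    ∈-shortestPaths : ∀ {u v p} → p ∈ shortestPaths u v → Σ (Shortest u v) λ s → Walk (Shortest.dist s) u v p
    ∈-shortestPaths {u} {v} p∈ with shortestPaths-spec u v
    ... | inj₁ (e , _) with subst (_ ∈_) e p∈
    ...   | ()
    ∈-shortestPaths {u} {v} p∈ | inj₂ s =
      s , uvWalks-sound (Shortest.dist s) (subst (_ ∈_) (Shortest.paths s) p∈)

    0<σ : ∀ {u v} → Shortest u v → 0 ℕ.< σ u v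
    0<σ s = ∈.∈-length (subst (_ ∈_) (sym (Shortest.paths s)) (uvWalks-complete (proj₂ (Shortest.reach s))))

-- Betweenness as a sum over shortest paths

module Centrality (F : FinGraph) where
  open FinGraph F
  open Betweenness F
  open Walks F

  avoids : V → V → V → Bool
  avoids x u v = not (does (u ≟ x)) ∧ not (does (v ≟ x))

  on? : (x : V) (p : List V) → Dec (T (any (λ y → does (x ≟ y)) p))
  on? x p = Bool.T? (any (λ y → does (x ≟ y)) p)

  -- The filter in `avoiding` becomes a factor 0 or 1, so that the sums for all vertices run over
  -- the same list `pairs vs` and can be exchanged.
  share : V → V → V → ℚ
  share x u v = ⟦ avoids x u v ⟧ * frac (σ-via u v x) (σ u v)

  weight : V → V → ℚ
  weight u v = frac 1 (σ u v)

  B-as-∑ : ∀ x → B x ≡ ∑ (λ p → share x (proj₁ p) (proj₂ p)) (pairs vs)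
  B-as-∑ x = trans
    (List.foldr-cong {g = λ p acc → frac (σ-via (proj₁ p) (proj₂ p) x) (σ (proj₁ p) (proj₂ p)) + acc}
      (λ { (u , v) acc → refl }) refl (avoiding x))
    (trans (∑-filter _ (λ p → frac (σ-via (proj₁ p) (proj₂ p) x) (σ (proj₁ p) (proj₂ p))) (pairs vs))
           (∑-cong {g = λ p → share x (proj₁ p) (proj₂ p)} (pairs vs) (λ { (u , v) → refl })))

  on⁻ : ∀ {x p} → T (any (λ y → does (x ≟ y)) p) → x ∈ p
  on⁻ {x} {p} t = Any.map (λ {y} → T-does⁻ (x ≟ y)) (Any.any⁻ (λ y → does (x ≟ y)) p t)

  on⁺ : ∀ {x p} → x ∈ p → T (any (λ y → does (x ≟ y)) p)
  on⁺ {x} x∈ = Any.any⁺ (λ y → does (x ≟ y)) (Any.map (λ {y} → T-does⁺ (x ≟ y)) x∈)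

  0≤weight : ∀ u v → 0ℚ ≤ weight u v
  0≤weight u v = 0≤frac-1 F (σ u v)

  0≤⟦⟧ : ∀ b → 0ℚ ≤ ⟦ b ⟧
  0≤⟦⟧ true  = 0≤1
  0≤⟦⟧ false = ≤-refl

  avoids-true : ∀ {x u v} → u ≢ x → v ≢ x → ⟦ avoids x u v ⟧ ≡ 1ℚ
  avoids-true {x} {u} {v} u≢x v≢x with u ≟ x | v ≟ x
  ... | yes u≡x | _       = ⊥-elim (u≢x u≡x)
  ... | no _    | yes v≡x = ⊥-elim (v≢x v≡x)
  ... | no _    | no _    = refl

  avoids-cases : ∀ x u v → ⟦ avoids x u v ⟧ ≡ 0ℚ ⊎ (u ≢ x × v ≢ x × ⟦ avoids x u v ⟧ ≡ 1ℚ)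
  avoids-cases x u v with u ≟ x | v ≟ x
  ... | yes _   | _       = inj₁ refl
  ... | no _    | yes _   = inj₁ refl
  ... | no u≢x  | no v≢x  = inj₂ (u≢x , v≢x , refl)

  pathShare : V → V → V → List V → ℚ
  pathShare x u v p = ⟦ avoids x u v ⟧ * (ind (on? x p) * weight u v)

  0≤pathShare : ∀ x u v p → 0ℚ ≤ pathShare x u v p
  0≤pathShare x u v p = 0≤p*q (0≤⟦⟧ (avoids x u v)) (0≤p*q (0≤ind (on? x p)) (0≤weight u v))

  share-as-∑ : ∀ x u v → share x u v ≡ ∑ (pathShare x u v) (shortestPaths u v)
  share-as-∑ x u v = trans
    (cong (⟦ avoids x u v ⟧ *_) (frac-filter F (on? x) (shortestPaths u v) (σ u v)))
    (sym (∑-*ˡ ⟦ avoids x u v ⟧ (λ p → ind (on? x p) * weight u v) (shortestPaths u v)))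

  0≤share : ∀ x u v → 0ℚ ≤ share x u v
  0≤share x u v = subst (0ℚ ≤_) (sym (share-as-∑ x u v)) (0≤∑ (shortestPaths u v) (0≤pathShare x u v))

  pathShare-on : ∀ {x u v p} → u ≢ x → v ≢ x → x ∈ p → pathShare x u v p ≡ weight u v
  pathShare-on {x} {u} {v} {p} u≢x v≢x x∈p = trans
    (cong₂ _*_ (avoids-true u≢x v≢x)
      (trans (cong (_* weight u v) (ind-yes (on? x p) (on⁺ x∈p))) (*-identityˡ (weight u v))))
    (*-identityˡ (weight u v))

  -- The left side vanishes unless `x` lies on `p` and differs from `u` and `v`, so `P` is asked for
  -- in that case only.
  pathShare-≤ : ∀ {x u v p} {P : Set} (d : Dec P) → (u ≢ x → v ≢ x → x ∈ p → P) →
                pathShare x u v p ≤ ind d * weight u v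
  pathShare-≤ {x} {u} {v} {p} d imp with avoids-cases x u v
  ... | inj₁ eq = subst (_≤ ind d * weight u v)
    (sym (trans (cong (_* (ind (on? x p) * weight u v)) eq) (*-zeroˡ (ind (on? x p) * weight u v))))
    (0≤p*q (0≤ind d) (0≤weight u v))
  ... | inj₂ (u≢x , v≢x , eq) = subst (_≤ ind d * weight u v)
    (sym (trans (cong (_* (ind (on? x p) * weight u v)) eq) (*-identityˡ (ind (on? x p) * weight u v))))
    (*-monoʳ (0≤weight u v) (ind-mono (on? x p) d (imp u≢x v≢x ∘ on⁻)))

  -- Only an inequality, since the sum is empty when the search finds no path.
  ∑-weight-≤1 : ∀ u v → ∑ (λ _ → weight u v) (shortestPaths u v) ≤ 1ℚ
  ∑-weight-≤1 u v with σ u v in eq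
  ... | zero  = subst (_≤ 1ℚ) (trans (cong (λ k → frac k 0) eq) (frac-length F (shortestPaths u v) 0)) 0≤1
  ... | suc k = ≤-reflexive (trans (sym (frac-length F (shortestPaths u v) (suc k)))
                  (trans (cong (λ j → frac j (suc k)) eq) (frac-n-n F {suc k} (s≤s z≤n))))

  ∑-weight-≡1 : ∀ {u v} → 0 ℕ.< σ u v → ∑ (λ _ → weight u v) (shortestPaths u v) ≡ 1ℚ
  ∑-weight-≡1 {u} {v} 0<σ = trans (sym (frac-length F (shortestPaths u v) (σ u v))) (frac-n-n F 0<σ)

-- Sums over the classes: c u is the index i with u in V(H i), and r i a member of class i

module BlowUpCentrality
  (F : FinGraph) {n : ℕ} (G : Graph n)
  (c : FinGraph.V F → Fin n) (r : Fin n → FinGraph.V F) (c∘r : ∀ i → c (r i) ≡ i)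
  (complete : ∀ x → x ∈ FinGraph.vs F) (unique : Unique (FinGraph.vs F))
  (symmetric : ∀ u v → T (FinGraph.adj F u v) → T (FinGraph.adj F v u))
  (across-classes : ∀ u v → Adj G (c u) (c v) → T (FinGraph.adj F u v))
  (classes : ∀ u v → T (FinGraph.adj F u v) → c u ≡ c v ⊎ Adj G (c u) (c v))
  where

  open FinGraph F
  open Betweenness F
  open Walks F
  open Complete complete
  open Centrality F
  open Paths G

  adj-symV : ∀ {u v} → T (adj u v) → T (adj v u)
  adj-symV {u} {v} = symmetric u v

  adj-across : ∀ {u v} → Adj G (c u) (c v) → T (adj u v)
  adj-across {u} {v} = across-classes u v

  adj-classes : ∀ {u v} → T (adj u v) → c u ≡ c v ⊎ Adj G (c u) (c v)
  adj-classes {u} {v} = classes u v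

  across : ∀ {u v i j} → c u ≡ i → c v ≡ j → Adj G i j → T (adj u v)
  across refl refl = adj-across

  reach-snoc : ∀ {k u w v} → Reach k u w → T (adj w v) → Reach (suc k) u v
  reach-snoc {k} {u} {v = v} r a = subst (λ j → Reach j u v) (ℕ.+-comm k 1) (r ∙ step a)

  reach-sym : ∀ {k u v} → Reach k u v → Reach k v u
  reach-sym (_ , nil)      = _ , nil
  reach-sym (_ , cons a w) = reach-snoc (reach-sym (_ , w)) (adj-symV a)

  shortestPaths-unique : ∀ u v → Unique (shortestPaths u v)
  shortestPaths-unique u v with shortestPaths-spec u v
  ... | inj₁ (e , _) = subst Unique (sym e) []
  ... | inj₂ s       = subst Unique (sym (Shortest.paths s)) (uvWalks-unique unique (Shortest.dist s) u v)

  -- The ends are distinct and nonadjacent, so their distance is exactly 2. The bound on `length vs`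
  -- puts length 2 within the search.
  common-neighbour⇒shortestPath : 2 ℕ.< length vs → ∀ {u v y} → u ≢ v → ¬ T (adj u v) →
    T (adj u y) → T (adj y v) → (u ∷ y ∷ v ∷ []) ∈ shortestPaths u v
  common-neighbour⇒shortestPath 2< {u} {v} {y} u≢v u≁v u~y y~v =
    subst (_ ∈_) (sym (trans paths (cong (λ k → uvWalks k u v) dist≡2)))
          (uvWalks-complete (cons u~y (cons y~v nil)))
    where
    open Shortest (reach⇒shortest 2< (step u~y ∙ step y~v))
    not-0 : ∀ {d} → d ≡ 0 → ¬ Reach d u v
    not-0 refl (_ , nil) = u≢v refl
    not-1 : ∀ {d} → d ≡ 1 → ¬ Reach d u v
    not-1 refl (_ , cons a nil) = u≁v a
    dist≡2 : dist ≡ 2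
    dist≡2 with dist in eq | reach | minimal
    ... | 0 | r | _ = ⊥-elim (not-0 refl r)
    ... | 1 | r | _ = ⊥-elim (not-1 refl r)
    ... | 2 | _ | _ = refl
    ... | suc (suc (suc d)) | _ | min =
      ⊥-elim (min (s≤s (s≤s (s≤s z≤n))) (step u~y ∙ step y~v))

  common-neighbour⇒weight≤share : 2 ℕ.< length vs → ∀ {u v y} → u ≢ v → ¬ T (adj u v) →
    T (adj u y) → T (adj y v) → weight u v ≤ share y u v
  common-neighbour⇒weight≤share 2< {u} {v} {y} u≢v u≁v u~y y~v =
    subst₂ _≤_ (pathShare-on {p = u ∷ y ∷ v ∷ []} (λ { refl → u≁v y~v }) (λ { refl → u≁v u~y }) (there (here refl)))
      (sym (share-as-∑ y u v))
      (∈⇒≤∑ (0≤pathShare y u v) (common-neighbour⇒shortestPath 2< u≢v u≁v u~y y~v))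

  size : Fin n → ℚ
  size i = ∑ (λ x → ind (c x Fin.≟ i)) vs

  nonAdjIn? : ∀ i u v → Dec (c u ≡ i × c v ≡ i × ¬ T (adj u v))
  nonAdjIn? i u v = (c u Fin.≟ i) ×-dec (c v Fin.≟ i) ×-dec ¬? (Bool.T? (adj u v))

  weightIn : Fin n → V → V → ℚ
  weightIn i u v = ind (nonAdjIn? i u v) * weight u v

  -- What class `i` gains as a whole from one pair. Under a uniform betweenness β these gains add up
  -- to `size i` times β.
  classShare : Fin n → V → V → ℚ
  classShare i u v = ∑ (λ x → ind (c x Fin.≟ i) * share x u v) vs

  0≤size : ∀ i → 0ℚ ≤ size i
  0≤size i = 0≤∑ vs (λ x → 0≤ind (c x Fin.≟ i))

  1≤size : ∀ i → 1ℚ ≤ size i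
  1≤size i = subst (_≤ size i) (ind-yes (c (r i) Fin.≟ i) (c∘r i))
    (∈⇒≤∑ (λ x → 0≤ind (c x Fin.≟ i)) (complete (r i)))

  0<size : ∀ i → 0ℚ < size i
  0<size i = <-≤-trans 0<1 (1≤size i)

  0≤weightIn : ∀ i u v → 0ℚ ≤ weightIn i u v
  0≤weightIn i u v = 0≤p*q (0≤ind (nonAdjIn? i u v)) (0≤weight u v)

  weightIn-yes : ∀ {i u v} → c u ≡ i × c v ≡ i × ¬ T (adj u v) → weightIn i u v ≡ weight u v
  weightIn-yes {i} {u} {v} p =
    trans (cong (_* weight u v) (ind-yes (nonAdjIn? i u v) p)) (*-identityˡ (weight u v))

  weightIn-no : ∀ {i u v} → ¬ (c u ≡ i × c v ≡ i × ¬ T (adj u v)) → weightIn i u v ≡ 0ℚ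
  weightIn-no {i} {u} {v} p =
    trans (cong (_* weight u v) (ind-no (nonAdjIn? i u v) p)) (*-zeroˡ (weight u v))

  0≤classShare : ∀ i u v → 0ℚ ≤ classShare i u v
  0≤classShare i u v = 0≤∑ vs (λ x → 0≤p*q (0≤ind (c x Fin.≟ i)) (0≤share x u v))

  share-≤⇒classShare-≤ : ∀ i u v {q} → (∀ x → c x ≡ i → share x u v ≤ q) →
                          classShare i u v ≤ size i * q
  share-≤⇒classShare-≤ i u v {q} le = subst (classShare i u v ≤_) (∑-*ʳ q (λ x → ind (c x Fin.≟ i)) vs)
    (∑-mono vs pointwise)
    where
    pointwise : ∀ x → ind (c x Fin.≟ i) * share x u v ≤ ind (c x Fin.≟ i) * q
    pointwise x with c x Fin.≟ i
    ... | yes eq = *-monoˡ 0≤1 (le x eq)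
    ... | no _   = ≤-reflexive (trans (*-zeroˡ (share x u v)) (sym (*-zeroˡ q)))

  ≤-share⇒≤-classShare : ∀ i u v {q} → (∀ x → c x ≡ i → q ≤ share x u v) →
                          size i * q ≤ classShare i u v
  ≤-share⇒≤-classShare i u v {q} le = subst (_≤ classShare i u v) (∑-*ʳ q (λ x → ind (c x Fin.≟ i)) vs)
    (∑-mono vs pointwise)
    where
    pointwise : ∀ x → ind (c x Fin.≟ i) * q ≤ ind (c x Fin.≟ i) * share x u v
    pointwise x with c x Fin.≟ i
    ... | yes eq = *-monoˡ 0≤1 (le x eq)
    ... | no _   = ≤-reflexive (trans (*-zeroˡ q) (sym (*-zeroˡ (share x u v))))

  classShare-as-∑ : ∀ i u v → classShare i u v ≡
    ∑ (λ p → ∑ (λ x → ind (c x Fin.≟ i) * pathShare x u v p) vs) (shortestPaths u v)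
  classShare-as-∑ i u v = trans
    (∑-cong vs (λ x → trans (cong (ind (c x Fin.≟ i) *_) (share-as-∑ x u v))
      (sym (∑-*ˡ (ind (c x Fin.≟ i)) (pathShare x u v) (shortestPaths u v)))))
    (∑-swap (λ x p → ind (c x Fin.≟ i) * pathShare x u v p) vs (shortestPaths u v))

  -- Every vertex of class `i` is a common neighbour of any two vertices of class `a`, and so lies
  -- on one of their shortest paths if they are nonadjacent.
  weightIn-≤-classShare : 2 ℕ.< length vs → ∀ {i a u v} → Adj G a i → u ≢ v →
                          size i * weightIn a u v ≤ classShare i u v
  weightIn-≤-classShare 2< {i} {a} {u} {v} a~i u≢v with nonAdjIn? a u v
  ... | no ¬a = subst (_≤ classShare i u v)
    (sym (trans (cong (size i *_) (weightIn-no ¬a)) (*-zeroʳ (size i)))) (0≤classShare i u v)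
  ... | yes (cu≡a , cv≡a , u≁v) = ≤-share⇒≤-classShare i u v (λ x cx≡i →
    subst (_≤ share x u v) (sym (weightIn-yes (cu≡a , cv≡a , u≁v)))
      (common-neighbour⇒weight≤share 2< u≢v u≁v
        (across cu≡a cx≡i a~i) (across cx≡i cv≡a (adj-sym a~i))))

  walk-connects : ∀ {k u v p i} → Walk k u v p → All (λ y → c y ≢ i) p → Connects i (c u) (c v)
  walk-connects nil               _              = ε
  walk-connects (cons a w@nil)        (u≢ ∷ ps@(w≢ ∷ _)) = (adj-classes a , u≢ , w≢) ◅ walk-connects w ps
  walk-connects (cons a w@(cons _ _)) (u≢ ∷ ps@(w≢ ∷ _)) = (adj-classes a , u≢ , w≢) ◅ walk-connects w ps

  -- Every shortest path meets class `i` and gives its weight to a vertex there. The weights add up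
  -- to 1 because the given walk makes `σ u v` positive.
  separated⇒1≤classShare : ∀ {k i u v} → c u ≢ i → c v ≢ i → ¬ Connects i (c u) (c v) →
    k ℕ.< length vs → Reach k u v → 1ℚ ≤ classShare i u v
  separated⇒1≤classShare {k} {i} {u} {v} cu≢i cv≢i sep k< reach =
    subst₂ _≤_ (∑-weight-≡1 (0<σ (reach⇒shortest k< reach))) (sym (classShare-as-∑ i u v))
      (∑-mono-All (All.tabulate meets))
    where
    meets : ∀ {p} → p ∈ shortestPaths u v →
            weight u v ≤ ∑ (λ x → ind (c x Fin.≟ i) * pathShare x u v p) vs
    meets {p} p∈ with Any.any? (λ y → c y Fin.≟ i) p
    ... | no none = ⊥-elim (sep (walk-connects (proj₂ (∈-shortestPaths p∈)) (All.¬Any⇒All¬ p none)))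
    ... | yes some = let y , y∈p , cy≡i = find some in
      ≤-trans (≤-reflexive (sym (trans
                (cong₂ _*_ (ind-yes (c y Fin.≟ i) cy≡i)
                  (pathShare-on (λ { refl → cu≢i cy≡i }) (λ { refl → cv≢i cy≡i }) y∈p))
                (*-identityˡ (weight u v)))))
              (∈⇒≤∑ (λ x → 0≤p*q (0≤ind (c x Fin.≟ i)) (0≤pathShare x u v p)) (complete y))

  -- The product form makes sums over all ordered pairs factor into class sizes. As `pairs` fixes
  -- one order, both orders are added when `p` and `q` differ.
  between : Fin n → Fin n → V → V → ℚ
  between p q u v = ind (c u Fin.≟ p) * ind (c v Fin.≟ q)

  0≤between : ∀ p q u v → 0ℚ ≤ between p q u v
  0≤between p q u v = 0≤p*q (0≤ind (c u Fin.≟ p)) (0≤ind (c v Fin.≟ q))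

  -- The contributions do not overlap. For ends in one class the `between` terms vanish, as `p ≢ q`,
  -- and at most one weight survives, as `a ≢ b`. For ends in different classes the weights vanish
  -- and at most one `between` term is nonzero.
  classShare-lower : 2 ℕ.< length vs → ∀ {i a b p q u v} → Adj G a i → Adj G b i → a ≢ b → p ≢ q → u ≢ v →
    (c u ≡ p × c v ≡ q ⊎ c u ≡ q × c v ≡ p → 1ℚ ≤ classShare i u v) →
    size i * (weightIn a u v + weightIn b u v) + (between p q u v + between p q v u) ≤ classShare i u v
  classShare-lower 2< {i} {a} {b} {p} {q} {u} {v} a~i b~i a≢b p≢q u≢v sep 
    with c u Fin.≟ c v
  ... | yes cu≡cv = subst (_≤ classShare i u v) (sym drop-between) same-class
    where
    between≡0 : ∀ {i j} → i ≢ j → between i j u v ≡ 0ℚ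
    between≡0 {i} {j} i≢j with c u Fin.≟ i
    ... | no _     = *-zeroˡ (ind (c v Fin.≟ j))
    ... | yes cu≡i = trans (*-identityˡ (ind (c v Fin.≟ j)))
      (ind-no (c v Fin.≟ j) (λ cv≡j → i≢j (trans (sym cu≡i) (trans cu≡cv cv≡j))))
    between-sym : between p q v u ≡ between q p u v
    between-sym = *-comm (ind (c v Fin.≟ p)) (ind (c u Fin.≟ q))
    drop-between : size i * (weightIn a u v + weightIn b u v) + (between p q u v + between p q v u)
                   ≡ size i * (weightIn a u v + weightIn b u v)
    drop-between = trans (cong (size i * (weightIn a u v + weightIn b u v) +_)
      (trans (cong₂ _+_ (between≡0 p≢q) (trans between-sym (between≡0 (p≢q ∘ sym)))) (+-identityˡ 0ℚ)))
      (+-identityʳ _)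
    same-class : size i * (weightIn a u v + weightIn b u v) ≤ classShare i u v
    same-class = by-class (c u Fin.≟ a)
      where
      by-class : Dec (c u ≡ a) → size i * (weightIn a u v + weightIn b u v) ≤ classShare i u v
      by-class (yes cu≡a) = subst (λ z → size i * z ≤ classShare i u v)
        (sym (trans (cong (weightIn a u v +_) (weightIn-no (λ (cu≡b , _) → a≢b (trans (sym cu≡a) cu≡b))))
                    (+-identityʳ (weightIn a u v))))
        (weightIn-≤-classShare 2< a~i u≢v)
      by-class (no cu≢a) = subst (λ z → size i * z ≤ classShare i u v)
        (sym (trans (cong (_+ weightIn b u v) (weightIn-no (cu≢a ∘ proj₁))) (+-identityˡ (weightIn b u v))))
        (weightIn-≤-classShare 2< b~i u≢v)
  ... | no cu≢cv = subst (_≤ classShare i u v) (sym drop-weights) different-classes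
    where
    drop-weights : size i * (weightIn a u v + weightIn b u v) + (between p q u v + between p q v u)
                   ≡ between p q u v + between p q v u
    drop-weights = trans (cong (_+ (between p q u v + between p q v u))
      (trans (cong (size i *_) (trans (cong₂ _+_ (weightIn-no no-class) (weightIn-no no-class)) (+-identityˡ 0ℚ)))
             (*-zeroʳ (size i))))
      (+-identityˡ _)
      where
      no-class : ∀ {j} → ¬ (c u ≡ j × c v ≡ j × ¬ T (adj u v))
      no-class (cu≡j , cv≡j , _) = cu≢cv (trans cu≡j (sym cv≡j))
    between-yes : ∀ {x y} → c x ≡ p → c y ≡ q → between p q x y ≡ 1ℚ
    between-yes {x} {y} cx cy = trans (cong₂ _*_ (ind-yes (c x Fin.≟ p) cx) (ind-yes (c y Fin.≟ q) cy)) (*-identityˡ 1ℚ)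
    between-no : ∀ {x y} → ¬ (c x ≡ p × c y ≡ q) → between p q x y ≡ 0ℚ
    between-no {x} {y} ne with c x Fin.≟ p
    ... | no _   = *-zeroˡ (ind (c y Fin.≟ q))
    ... | yes cx = trans (*-identityˡ (ind (c y Fin.≟ q))) (ind-no (c y Fin.≟ q) (λ cy → ne (cx , cy)))
    different-classes : between p q u v + between p q v u ≤ classShare i u v
    different-classes with (c u Fin.≟ p) ×-dec (c v Fin.≟ q) | (c v Fin.≟ p) ×-dec (c u Fin.≟ q)
    ... | yes (cu , cv) | _ = subst (_≤ classShare i u v)
      (sym (cong₂ _+_ (between-yes cu cv) (between-no (λ (cv′ , _) → p≢q (trans (sym cv′) cv)))))
      (subst (_≤ classShare i u v) (sym (+-identityʳ 1ℚ)) (sep (inj₁ (cu , cv))))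
    ... | no ne | yes (cv , cu) = subst (_≤ classShare i u v)
      (sym (cong₂ _+_ (between-no ne) (between-yes cv cu)))
      (subst (_≤ classShare i u v) (sym (+-identityˡ 1ℚ)) (sep (inj₂ (cu , cv))))
    ... | no ne | no ne′ = subst (_≤ classShare i u v)
      (sym (trans (cong₂ _+_ (between-no ne) (between-no ne′)) (+-identityˡ 0ℚ)))
      (0≤classShare i u v)

  -- Classes of leaves

  module Leaf {l s : Fin n} (l~s : Adj G l s) (leaf : ∀ i → Adj G l i → i ≡ s) where

    neighbour-class : ∀ {x a} → c x ≡ l → T (adj a x) → c a ≡ l ⊎ c a ≡ s
    neighbour-class refl a with adj-classes a
    ... | inj₁ eq = inj₁ eq
    ... | inj₂ e  = inj₂ (leaf _ (adj-sym e))

    Near : V → V → Set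
    Near u v = ∃[ k ] k ℕ.≤ 2 × Reach k u v

    near-sym : ∀ {u v} → Near u v → Near v u
    near-sym (k , k≤2 , r) = k , k≤2 , reach-sym r

    near₁ : ∀ {u v} → T (adj u v) → Near u v
    near₁ a = 1 , s≤s z≤n , step a

    near₂ : ∀ {u w v} → T (adj u w) → T (adj w v) → Near u v
    near₂ a b = 2 , ℕ.≤-refl , step a ∙ step b

    -- Each of `a` and `b` lies in class `l` or `s`. If the classes differ, `a` and `b` are adjacent
    -- and `x` is skipped. If both lie in class `s`, then `x` or `a` is adjacent to `w`. If both lie
    -- in class `l`, then `w` lies in class `s`, next to `a`, or in class `l`, with any vertex of
    -- class `s` in between.
    shortcut : ∀ {a x b w} → c x ≡ l → T (adj a x) → T (adj x b) → T (adj b w) → Near a w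
    shortcut {a} {x} {b} {w} cx≡l a~x x~b b~w
      with neighbour-class cx≡l a~x | neighbour-class cx≡l (adj-symV x~b)
    ... | inj₁ ca≡l | inj₂ cb≡s = near₂ (across ca≡l cb≡s l~s) b~w
    ... | inj₂ ca≡s | inj₁ cb≡l = near₂ (across ca≡s cb≡l (adj-sym l~s)) b~w
    ... | inj₁ ca≡l | inj₁ cb≡l with neighbour-class cb≡l (adj-symV b~w)
    ...   | inj₁ cw≡l = near₂ (across ca≡l (c∘r s) l~s) (across (c∘r s) cw≡l (adj-sym l~s))
    ...   | inj₂ cw≡s = near₁ (across ca≡l cw≡s l~s)
    shortcut {a} {x} {b} {w} cx≡l a~x x~b b~w | inj₂ ca≡s | inj₂ cb≡s with adj-classes b~w
    ...   | inj₁ cb≡cw = near₂ a~x (across cx≡l (trans (sym cb≡cw) cb≡s) l~s)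
    ...   | inj₂ e     = near₁ (adj-across (subst (λ i → Adj G i (c w)) (trans cb≡s (sym ca≡s)) e))

    -- By `shortcut`, a shortest path has just one edge on either side of `x`. Its ends then lie in
    -- classes `l` and `s`, and in the same one, for otherwise they would be adjacent.
    interior : ∀ {x u v p} → c x ≡ l → u ≢ x → v ≢ x → u ≢ v →
      p ∈ shortestPaths u v → x ∈ p →
      ¬ T (adj u v) × (c u ≡ l × c v ≡ l ⊎ c u ≡ s × c v ≡ s) × p ≡ u ∷ x ∷ v ∷ []
    interior {x} {u} {v} {p} cx≡l u≢x v≢x u≢v p∈ x∈p with ∈-shortestPaths p∈
    ... | record { dist = d ; minimal = minimal } , w with split w x∈p
    ...   | zero , _ , (_ , nil) , _ , _ = ⊥-elim (u≢x refl)
    ...   | _ , zero , _ , (_ , nil) , _ = ⊥-elim (v≢x refl)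
    ...   | suc i , suc j , r , (_ , cons {w = b} x~b w₂) , refl with unsnoc r
    ...     | a , r₁ , a~x = ends i j r₁ w₂ w minimal
      where
      ends : ∀ i j → Reach i u a → ∀ {q} → Walk j b v q → Walk (suc i ℕ.+ suc j) u v p →
             (∀ {k} → k ℕ.< suc i ℕ.+ suc j → ¬ Reach k u v) →
             ¬ T (adj u v) × (c u ≡ l × c v ≡ l ⊎ c u ≡ s × c v ≡ s) × p ≡ u ∷ x ∷ v ∷ []
      ends (suc i) j r₁ w₂ w min with unsnoc r₁
      ... | z , r₂ , z~a =
        -- On the side of `u` the shortcut is applied to the reversed stretch `b`, `x`, `a`, `z`.
        let k , k≤2 , rₖ = near-sym (shortcut cx≡l (adj-symV x~b) (adj-symV a~x) (adj-symV z~a))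
        in ⊥-elim (min (s≤s (subst (i ℕ.+ (k ℕ.+ j) ℕ.≤_) (ℕ.+-suc i (suc j))
             (ℕ.+-monoʳ-≤ i (ℕ.+-monoˡ-≤ j k≤2)))) (r₂ ∙ rₖ ∙ (_ , w₂)))
      ends zero (suc j) (_ , nil) (cons b~z w₃) w min =
        let k , k≤2 , rₖ = shortcut cx≡l a~x x~b b~z
        in ⊥-elim (min (s≤s (ℕ.+-monoˡ-≤ j k≤2)) (rₖ ∙ (_ , w₃)))
      ends zero zero (_ , nil) nil w min = u≁v , ends-class , shape w x∈p
        where
        u≁v : ¬ T (adj u v)
        u≁v u~v = min ℕ.≤-refl (step u~v)
        ends-class : c u ≡ l × c v ≡ l ⊎ c u ≡ s × c v ≡ s
        ends-class with neighbour-class cx≡l a~x | neighbour-class cx≡l (adj-symV x~b)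
        ... | inj₁ cu≡l | inj₁ cv≡l = inj₁ (cu≡l , cv≡l)
        ... | inj₂ cu≡s | inj₂ cv≡s = inj₂ (cu≡s , cv≡s)
        ... | inj₁ cu≡l | inj₂ cv≡s = ⊥-elim (u≁v (across cu≡l cv≡s l~s))
        ... | inj₂ cu≡s | inj₁ cv≡l = ⊥-elim (u≁v (across cu≡s cv≡l (adj-sym l~s)))
        shape : ∀ {q} → Walk 2 u v q → x ∈ q → q ≡ u ∷ x ∷ v ∷ []
        shape (cons _ (cons _ nil)) (here x≡u)                 = ⊥-elim (u≢x (sym x≡u))
        shape (cons _ (cons _ nil)) (there (here refl))        = refl
        shape (cons _ (cons _ nil)) (there (there (here x≡v))) = ⊥-elim (v≢x (sym x≡v))

    -- Only the path `u ∷ x ∷ v ∷ []` can contribute, and it is listed at most once.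
    share-≤-weight : ∀ {x u v} → c x ≡ l → u ≢ v → share x u v ≤ weight u v
    share-≤-weight {x} {u} {v} cx≡l u≢v = subst₂ _≤_ (sym (share-as-∑ x u v)) (*-identityˡ (weight u v))
      (≤-trans (∑-mono-All (All.tabulate pathShare-≤-ind))
        (≤-trans (≤-reflexive (∑-*ʳ (weight u v) (λ p → ind (p ≟ₗ (u ∷ x ∷ v ∷ []))) (shortestPaths u v)))
          (*-monoʳ (0≤weight u v) (∑-ind-≤1 _≟ₗ_ (u ∷ x ∷ v ∷ []) (shortestPaths-unique u v)))))
      where
      _≟ₗ_ = List.≡-dec _≟_
      pathShare-≤-ind : ∀ {p} → p ∈ shortestPaths u v →
                        pathShare x u v p ≤ ind (p ≟ₗ (u ∷ x ∷ v ∷ [])) * weight u v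
      pathShare-≤-ind {p} p∈ = pathShare-≤ {p = p} (p ≟ₗ (u ∷ x ∷ v ∷ []))
        (λ u≢x v≢x x∈p → proj₂ (proj₂ (interior cx≡l u≢x v≢x u≢v p∈ x∈p)))

    share-≤0 : ∀ {x u v} → c x ≡ l → u ≢ v →
      ¬ (c u ≡ l × c v ≡ l × ¬ T (adj u v)) → ¬ (c u ≡ s × c v ≡ s × ¬ T (adj u v)) → share x u v ≤ 0ℚ
    share-≤0 {x} {u} {v} cx≡l u≢v ¬l ¬s = subst₂ _≤_ (sym (share-as-∑ x u v)) (∑-0 (shortestPaths u v))
      (∑-mono-All (All.tabulate (λ {p} p∈ → subst (pathShare x u v p ≤_) (*-zeroˡ (weight u v))
        -- The indicator of the empty proposition serves as the bound 0.
        (pathShare-≤ {p = p} (no (λ ())) (impossible p∈)))))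
      where
      impossible : ∀ {p} → p ∈ shortestPaths u v → u ≢ x → v ≢ x → x ∈ p → ⊥
      impossible p∈ u≢x v≢x x∈p with interior cx≡l u≢x v≢x u≢v p∈ x∈p
      ... | u≁v , inj₁ (cu , cv) , _ = ¬l (cu , cv , u≁v)
      ... | u≁v , inj₂ (cu , cv) , _ = ¬s (cu , cv , u≁v)

    share-upper : ∀ {x u v} → c x ≡ l → u ≢ v → share x u v ≤ weightIn l u v + weightIn s u v
    share-upper {x} {u} {v} cx≡l u≢v with nonAdjIn? l u v | nonAdjIn? s u v
    ... | yes isl | _ = ≤-trans (share-≤-weight cx≡l u≢v)
      (≤-trans (≤-reflexive (sym (weightIn-yes isl))) (p≤p+q (0≤weightIn s u v)))
    ... | no _ | yes iss = ≤-trans (share-≤-weight cx≡l u≢v)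
      (≤-trans (≤-reflexive (sym (weightIn-yes iss))) (q≤p+q (0≤weightIn l u v)))
    ... | no ¬l | no ¬s = ≤-trans (share-≤0 cx≡l u≢v ¬l ¬s)
      (0≤p+q (0≤weightIn l u v) (0≤weightIn s u v))

    -- A shortest path has at most one interior vertex in class `l`, its second vertex, so the class
    -- receives the weight of each path at most once.
    classShare-≤1 : ∀ {u v} → u ≢ v → classShare l u v ≤ 1ℚ
    classShare-≤1 {u} {v} u≢v = subst (_≤ 1ℚ) (sym (classShare-as-∑ l u v))
      (≤-trans (∑-mono-All (All.tabulate one-interior)) (∑-weight-≤1 u v))
      where
      second : List V → V
      second (_ ∷ z ∷ _) = z
      -- A default for lists that are too short; `interior` rules them out where the value matters.
      second _           = u
      one-interior : ∀ {p} → p ∈ shortestPaths u v →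
                     ∑ (λ x → ind (c x Fin.≟ l) * pathShare x u v p) vs ≤ weight u v
      one-interior {p} p∈ = ≤-trans (∑-mono vs pointwise)
        (≤-trans (≤-reflexive (∑-*ʳ (weight u v) (λ x → ind (x ≟ second p)) vs))
          (subst (∑ (λ x → ind (x ≟ second p)) vs * weight u v ≤_) (*-identityˡ (weight u v))
            (*-monoʳ (0≤weight u v) (∑-ind-≤1 _≟_ (second p) unique))))
        where
        pointwise : ∀ x → ind (c x Fin.≟ l) * pathShare x u v p ≤ ind (x ≟ second p) * weight u v
        pointwise x with c x Fin.≟ l
        ... | no _ = subst (_≤ ind (x ≟ second p) * weight u v) (sym (*-zeroˡ (pathShare x u v p)))
          (0≤p*q (0≤ind (x ≟ second p)) (0≤weight u v))
        ... | yes cx≡l = subst (_≤ ind (x ≟ second p) * weight u v) (sym (*-identityˡ (pathShare x u v p)))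
          (pathShare-≤ {p = p} (x ≟ second p)
            (λ u≢x v≢x x∈p → sym (cong second (proj₂ (proj₂ (interior cx≡l u≢x v≢x u≢v p∈ x∈p))))))

    -- For nonadjacent ends in class `l` the bound 1 for the whole class replaces
    -- `size l * weightIn l u v`. After summation this gives a term in `size l` alone instead of
    -- `classWeight l`.
    classShare-upper : ∀ {u v} → u ≢ v → classShare l u v ≤ between l l u v + size l * weightIn s u v
    classShare-upper {u} {v} u≢v with nonAdjIn? l u v
    ... | yes (cu≡l , cv≡l , _) = ≤-trans (classShare-≤1 u≢v)
      (≤-trans (≤-reflexive (sym (cong₂ _*_ (ind-yes (c u Fin.≟ l) cu≡l) (ind-yes (c v Fin.≟ l) cv≡l))))
        (p≤p+q (0≤p*q (0≤size l) (0≤weightIn s u v))))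
    ... | no ¬l = ≤-trans (share-≤⇒classShare-≤ l u v (λ x cx≡l →
                    ≤-trans (share-upper cx≡l u≢v)
                      (≤-reflexive (trans (cong (_+ weightIn s u v) (weightIn-no ¬l)) (+-identityˡ (weightIn s u v))))))
                  (q≤p+q (0≤between l l u v))

  -- Double counting against a uniform betweenness

  ∑-between : ∀ p q →
    ∑ (λ e → between p q (proj₁ e) (proj₂ e) + between p q (proj₂ e) (proj₁ e)) (pairs vs)
      + ∑ (λ u → between p q u u) vs ≡ size p * size q
  ∑-between p q = trans (∑-pairs F (between p q) vs)
    (trans (∑-cong vs (λ u → ∑-*ˡ (ind (c u Fin.≟ p)) (λ v → ind (c v Fin.≟ q)) vs))
           (∑-*ʳ (size q) (λ u → ind (c u Fin.≟ p)) vs))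

  ∑-between-≢ : ∀ {p q} → p ≢ q →
    ∑ (λ e → between p q (proj₁ e) (proj₂ e) + between p q (proj₂ e) (proj₁ e)) (pairs vs)
      ≡ size p * size q
  ∑-between-≢ {p} {q} p≢q = trans (sym (+-identityʳ total)) (trans (cong (total +_) (sym diagonal)) (∑-between p q))
    where
    total = ∑ (λ e → between p q (proj₁ e) (proj₂ e) + between p q (proj₂ e) (proj₁ e)) (pairs vs)
    between-diagonal : ∀ u → between p q u u ≡ 0ℚ
    between-diagonal u with c u Fin.≟ p
    ... | no _     = *-zeroˡ (ind (c u Fin.≟ q))
    ... | yes cu≡p = trans (*-identityˡ (ind (c u Fin.≟ q)))
      (ind-no (c u Fin.≟ q) (λ cu≡q → p≢q (trans (sym cu≡p) cu≡q)))
    diagonal : ∑ (λ u → between p q u u) vs ≡ 0ℚ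
    diagonal = trans (∑-cong vs between-diagonal) (∑-0 vs)

  -- The square also counts the diagonal, which contains the representative `r l`. This is the
  -- source of the strictness in `size*β-<`.
  ∑-between-< : ∀ l → ∑ (λ e → between l l (proj₁ e) (proj₂ e)) (pairs vs) < size l * size l
  ∑-between-< l = subst (half <_)
    (trans (cong (_+ diagonal) (sym (∑-+ ordered reversed (pairs vs)))) (∑-between l l))
    (≤-<-trans (p≤p+q (0≤∑ (pairs vs) (λ e → 0≤between l l (proj₂ e) (proj₁ e))))
      (subst (_< (half + half′) + diagonal) (+-identityʳ (half + half′))
        (+-monoʳ-< (half + half′) 0<diagonal)))
    where
    ordered reversed : V × V → ℚ
    ordered e  = between l l (proj₁ e) (proj₂ e)
    reversed e = between l l (proj₂ e) (proj₁ e)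
    half     = ∑ ordered (pairs vs)
    half′    = ∑ reversed (pairs vs)
    diagonal = ∑ (λ u → between l l u u) vs
    0<diagonal : 0ℚ < diagonal
    0<diagonal = <-≤-trans 0<1 (subst (_≤ diagonal)
      (trans (cong₂ _*_ (ind-yes (c (r l) Fin.≟ l) (c∘r l)) (ind-yes (c (r l) Fin.≟ l) (c∘r l))) (*-identityˡ 1ℚ))
      (∈⇒≤∑ (λ u → 0≤between l l u u) (complete (r l))))

  classWeight : Fin n → ℚ
  classWeight i = ∑ (λ e → weightIn i (proj₁ e) (proj₂ e)) (pairs vs)

  0≤classWeight : ∀ i → 0ℚ ≤ classWeight i
  0≤classWeight i = 0≤∑ (pairs vs) (λ e → 0≤weightIn i (proj₁ e) (proj₂ e))

  pairs-distinct : All (λ e → proj₁ e ≢ proj₂ e) (pairs vs)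
  pairs-distinct = All-pairs F unique

  -- Inner vertices are lifted to representatives, so one length serves all choices of the two ends.
  lift-path : ∀ {p q R} → Linked (Adj G) (p ∷ R) → q ∈ R →
    ∃[ k ] k ℕ.≤ length R × (∀ {u v} → c u ≡ p → c v ≡ q → Reach k u v)
  lift-path (a ∷ l) (here refl) = 1 , s≤s z≤n , λ cu cv → step (across cu cv a)
  lift-path {R = x ∷ R} (a ∷ l) (there q∈) =
    let k , k≤ , reach = lift-path l q∈
    in suc k , s≤s k≤ , λ cu cv → step (across cu (c∘r x) a) ∙ reach (c∘r x) cv

  path-length≤ : ∀ {P} → IsPath P → length P ℕ.≤ length vs
  path-length≤ {P} (_ , u) = subst (ℕ._≤ length vs) (List.length-map r P)
    (Unique-⊆⇒length≤ (Unique.map⁺ (λ {i} {j} eq → trans (sym (c∘r i)) (trans (cong c eq) (c∘r j))) u)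
      (λ {x} _ → complete x))

  module Uniform (β : ℚ) (uniform : ∀ x → B x ≡ β) (2< : 2 ℕ.< length vs) where

    size*β : ∀ i → size i * β ≡ ∑ (λ e → classShare i (proj₁ e) (proj₂ e)) (pairs vs)
    size*β i = trans (sym (∑-*ʳ β (λ x → ind (c x Fin.≟ i)) vs))
      (trans (∑-cong vs (λ x → trans (cong (ind (c x Fin.≟ i) *_) (trans (sym (uniform x)) (B-as-∑ x)))
               (sym (∑-*ˡ (ind (c x Fin.≟ i)) (λ e → share x (proj₁ e) (proj₂ e)) (pairs vs)))))
             (∑-swap (λ x e → ind (c x Fin.≟ i) * share x (proj₁ e) (proj₂ e)) vs (pairs vs)))

    β-≤ : ∀ {l s} → Adj G l s → (∀ i → Adj G l i → i ≡ s) → β ≤ classWeight l + classWeight s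
    β-≤ {l} {s} l~s leaf = subst₂ _≤_ (trans (sym (B-as-∑ (r l))) (uniform (r l)))
      (∑-+ (λ e → weightIn l (proj₁ e) (proj₂ e)) (λ e → weightIn s (proj₁ e) (proj₂ e)) (pairs vs))
      (∑-mono-All (All.map (Leaf.share-upper l~s leaf (c∘r l)) pairs-distinct))

    size*β-< : ∀ {l s} → Adj G l s → (∀ i → Adj G l i → i ≡ s) →
               size l * β < size l * size l + size l * classWeight s
    size*β-< {l} {s} l~s leaf = subst (_< size l * size l + size l * classWeight s) (sym (size*β l))
      (≤-<-trans (∑-mono-All (All.map (Leaf.classShare-upper l~s leaf) pairs-distinct))
        (subst (_< size l * size l + size l * classWeight s)
          (sym (trans (∑-+ (λ e → between l l (proj₁ e) (proj₂ e)) (λ e → size l * weightIn s (proj₁ e) (proj₂ e)) (pairs vs))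
            (cong (∑ (λ e → between l l (proj₁ e) (proj₂ e)) (pairs vs) +_)
              (∑-*ˡ (size l) (λ e → weightIn s (proj₁ e) (proj₂ e)) (pairs vs)))))
          (+-monoˡ-< (size l * classWeight s) (∑-between-< l))))

    -- This is `classShare-lower` summed over all pairs. The bound on `k` keeps the separated pairs
    -- within the search for shortest paths.
    ≤-size*β : ∀ {i a b p q k} → Adj G a i → Adj G b i → a ≢ b → p ≢ q → p ≢ i → q ≢ i →
      ¬ Connects i q p → k ℕ.< length vs → (∀ {u v} → c u ≡ p → c v ≡ q → Reach k u v) →
      size i * (classWeight a + classWeight b) + size p * size q ≤ size i * β
    ≤-size*β {i} {a} {b} {p} {q} {k} a~i b~i a≢b p≢q p≢i q≢i sep k< reach =
      subst₂ _≤_ total (sym (size*β i))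
        (∑-mono-All (All.map (λ u≢v → classShare-lower 2< a~i b~i a≢b p≢q u≢v separated) pairs-distinct))
      where
      wa wb both : V × V → ℚ
      wa e   = weightIn a (proj₁ e) (proj₂ e)
      wb e   = weightIn b (proj₁ e) (proj₂ e)
      both e = between p q (proj₁ e) (proj₂ e) + between p q (proj₂ e) (proj₁ e)
      total : ∑ (λ e → size i * (wa e + wb e) + both e) (pairs vs)
              ≡ size i * (classWeight a + classWeight b) + size p * size q
      total = trans (∑-+ (λ e → size i * (wa e + wb e)) both (pairs vs))
        (cong₂ _+_ (trans (∑-*ˡ (size i) (λ e → wa e + wb e) (pairs vs)) (cong (size i *_) (∑-+ wa wb (pairs vs))))
                   (∑-between-≢ p≢q))
      connects-sym : ∀ {u v} → Connects i u v → Connects i v u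
      connects-sym = Star.reverse (λ { (inj₁ refl , u≢ , v≢) → inj₁ refl , v≢ , u≢
                                     ; (inj₂ e , u≢ , v≢)    → inj₂ (adj-sym e) , v≢ , u≢ })
      separated : ∀ {u v} → c u ≡ p × c v ≡ q ⊎ c u ≡ q × c v ≡ p → 1ℚ ≤ classShare i u v
      separated (inj₁ (refl , refl)) = separated⇒1≤classShare p≢i q≢i (sep ∘ connects-sym) k< (reach refl refl)
      separated (inj₂ (refl , refl)) = separated⇒1≤classShare q≢i p≢i sep k< (reach-sym (reach refl refl))

    -- Inequalities along a path between two leaves, and the contradiction.

    module _ (acyclic : ∀ cs → ¬ IsCycle G cs) where

      -- Here `l` and `t` are both the two neighbours of `s` and the two classes separated by it.
      -- The term `size s * classWeight l` cancels against the upper bound `β-≤`.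
      support-bound : ∀ {l s t R} → IsPath (l ∷ s ∷ t ∷ R) → (∀ i → Adj G l i → i ≡ s) →
        size s * classWeight t + size l * size t ≤ size s * classWeight s
      support-bound {l} {s} {t} p@(l~s ∷ s~t ∷ _ , (l≢s ∷ l≢t ∷ _) ∷ (s≢t ∷ _) ∷ _) leaf =
        let k , k≤ , reach = lift-path (proj₁ p) (there (here refl))
        in arith (≤-size*β l~s (adj-sym s~t) l≢t l≢t l≢s (s≢t ∘ sym)
             (path-separates acyclic p (here refl)) (ℕ.<-≤-trans (s≤s k≤) (path-length≤ p)) reach)
        where
        arith : size s * (classWeight l + classWeight t) + size l * size t ≤ size s * β →
                size s * classWeight t + size l * size t ≤ size s * classWeight s
        arith le = +-cancelˡ-≤ (size s * classWeight l) (subst₂ _≤_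
          (solve 4 (λ a b c d → a :* (b :+ c) :+ d := a :* b :+ (a :* c :+ d)) refl
             (size s) (classWeight l) (classWeight t) (size l * size t))
          (*-distribˡ-+ (size s) (classWeight l) (classWeight s))
          (≤-trans le (*-monoˡ (0≤size s) (β-≤ l~s leaf))))

      -- Class `t` separates `l` from `q`. With β below `size l + classWeight s`, the term
      -- `size t * classWeight s` cancels; each conclusion then drops one of the two summands left
      -- on the smaller side.
      beyond-bound : ∀ {l s t b q R} → IsPath (l ∷ s ∷ t ∷ b ∷ R) → q ∈ b ∷ R → (∀ i → Adj G l i → i ≡ s) →
        size q < size t × classWeight b < size l
      beyond-bound {l} {s} {t} {b} {q}
        p@(l~s ∷ s~t ∷ t~b ∷ _ , (l≢s ∷ l≢t ∷ l≢) ∷ (s≢t ∷ s≢b ∷ _) ∷ t≢ ∷ _) q∈ leaf =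
        let k , k≤ , reach = lift-path (proj₁ p) (there (there q∈))
        in arith (≤-size*β s~t (adj-sym t~b) s≢b (All.lookup l≢ q∈) l≢t (All.lookup t≢ q∈ ∘ sym)
             -- The separation is applied to the path starting at `s`, so a connection from `q` to
             -- `l` is first prolonged by the edge to `s`.
             (λ w → path-separates acyclic (path-tail p) q∈ (w ◅◅ (inj₂ l~s , l≢t , s≢t) ◅ ε))
             (ℕ.<-≤-trans (s≤s k≤) (path-length≤ p)) reach)
        where
        arith : size t * (classWeight s + classWeight b) + size l * size q ≤ size t * β →
                size q < size t × classWeight b < size l
        arith le =
            *-cancelˡ-< (0≤size l) (subst (size l * size q <_) (*-comm (size t) (size l))
              (≤-<-trans (q≤p+q (0≤p*q (0≤size t) (0≤classWeight b))) bound))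
          , *-cancelˡ-< (0≤size t) (≤-<-trans (p≤p+q (0≤p*q (0≤size l) (0≤size q))) bound)
          where
          β< : β < size l + classWeight s
          β< = *-cancelˡ-< (0≤size l) (subst (size l * β <_)
                 (sym (*-distribˡ-+ (size l) (size l) (classWeight s))) (size*β-< l~s leaf))
          bound : size t * classWeight b + size l * size q < size t * size l
          bound = +-cancelˡ-< (size t * classWeight s) (subst₂ _<_
            (solve 4 (λ a b c d → a :* (b :+ c) :+ d := a :* b :+ (a :* c :+ d)) refl
               (size t) (classWeight s) (classWeight b) (size l * size q))
            (solve 3 (λ a b c → a :* (b :+ c) := a :* c :+ a :* b) refl
               (size t) (size l) (classWeight s))
            (≤-<-trans le (*-monoˡ-< (0<size t) β<)))

      beyond-size : ∀ {l s t q R} → IsPath (l ∷ s ∷ t ∷ R) → q ∈ R → (∀ i → Adj G l i → i ≡ s) →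
        size q < size t
      beyond-size {R = _ ∷ _} p q∈ leaf = proj₁ (beyond-bound p q∈ leaf)

      0<size*size : ∀ i j → 0ℚ < size i * size j
      0<size*size i j = subst (_< size i * size j) (*-zeroʳ (size i)) (*-monoˡ-< (0<size i) (0<size j))

      ¬leaf-to-leaf-path : ∀ P → IsPath P → 4 ℕ.≤ length P →
        NeighboursOfHeadIn acyclic P → NeighboursOfHeadIn acyclic (reverse P) → ⊥
      ¬leaf-to-leaf-path (_ ∷ []) p (s≤s ())
      ¬leaf-to-leaf-path (_ ∷ _ ∷ []) p (s≤s (s≤s ()))
      ¬leaf-to-leaf-path (_ ∷ _ ∷ _ ∷ []) p (s≤s (s≤s (s≤s ())))
      ¬leaf-to-leaf-path (a ∷ b ∷ c′ ∷ d ∷ []) p _ h h′ = <-asym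
        (heavier p (head-leaf acyclic p h)) (heavier p′ (head-leaf acyclic p′ h′))
        where
        p′ = reverse-path p
        heavier : ∀ {l s t R} → IsPath (l ∷ s ∷ t ∷ R) → (∀ i → Adj G l i → i ≡ s) → classWeight t < classWeight s
        -- Strictness comes from `size l * size t`, which is positive because classes are nonempty.
        heavier {l} {s} {t} p leaf = *-cancelˡ-< (0≤size s)
          (<-≤-trans (subst (_< size s * classWeight t + size l * size t) (+-identityʳ (size s * classWeight t))
                       (+-monoʳ-< (size s * classWeight t) (0<size*size l t)))
                     (support-bound p leaf))
      ¬leaf-to-leaf-path (a ∷ b ∷ c′ ∷ d ∷ e ∷ []) p _ h h′ =
        <-asym (larger p (head-leaf acyclic p h) p′ (head-leaf acyclic p′ h′))
               (larger p′ (head-leaf acyclic p′ h′) p (head-leaf acyclic p h))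
        where
        p′ = reverse-path p
        larger : ∀ {l s t s′ l′} → IsPath (l ∷ s ∷ t ∷ s′ ∷ l′ ∷ []) → (∀ i → Adj G l i → i ≡ s) →
                 IsPath (l′ ∷ s′ ∷ t ∷ s ∷ l ∷ []) → (∀ i → Adj G l′ i → i ≡ s′) → size l < size l′
        larger {l} {s} {t} {s′} {l′} p leaf p′ leaf′ =
          -- Seen from the far end, `s` is the vertex after `t`; this bounds both its size and its
          -- class weight.
          let s<t , w<l′ = beyond-bound p′ (here refl) leaf′
          in ≤-<-trans (*-cancelˡ-≤-pos (size t) {{ℚ.positive (0<size t)}} (begin
               size t * size l                           ≡⟨ *-comm (size t) (size l) ⟩
               size l * size t                           ≤⟨ q≤p+q (0≤p*q (0≤size s) (0≤classWeight t)) ⟩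
               size s * classWeight t + size l * size t  ≤⟨ support-bound p leaf ⟩
               size s * classWeight s                    ≤⟨ *-monoʳ (0≤classWeight s) (<⇒≤ s<t) ⟩
               size t * classWeight s                    ∎)) w<l′
          where open ≤-Reasoning
      -- With six or more vertices, `d`, the third from the far end, lies beyond `c′` seen from `a`,
      -- and `c′` lies beyond `d` seen from `f`.
      ¬leaf-to-leaf-path (a ∷ b ∷ c′ ∷ x ∷ y ∷ z ∷ R) p _ h h′ with lastThree x y z R
      ... | Q , d , e , f , eq = <-asym
        (beyond-size p (subst (d ∈_) (sym eq) (∈.∈-++⁺ʳ Q (here refl))) (head-leaf acyclic p h))
        (beyond-size p′ (Any.reverse⁺ {xs = a ∷ b ∷ c′ ∷ Q} (there (there (here refl))))
          (head-leaf acyclic p′ (subst (NeighboursOfHeadIn acyclic) reversed h′)))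
        where
        reversed : reverse (a ∷ b ∷ c′ ∷ x ∷ y ∷ z ∷ R) ≡ f ∷ e ∷ d ∷ reverse (a ∷ b ∷ c′ ∷ Q)
        reversed = trans (cong (λ M → reverse (a ∷ b ∷ c′ ∷ M)) eq)
                         (List.reverse-++ (a ∷ b ∷ c′ ∷ Q) (d ∷ e ∷ f ∷ []))
        p′ : IsPath (f ∷ e ∷ d ∷ reverse (a ∷ b ∷ c′ ∷ Q))
        p′ = subst IsPath reversed (reverse-path p)

-- The blow-up

module _ {n : ℕ} (G : Graph n) (m : Fin n → ℕ) (H : (i : Fin n) → Graph (suc (m i))) where
  open FinGraph (blowUp G m H)

  blowUp-complete : ∀ x → x ∈ vs
  blowUp-complete (i , a) = ∈.∈-concatMap⁺ (λ i → map (i ,_) (allFin (suc (m i))))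
    (lose (∈.∈-allFin i) (∈.∈-map⁺ (i ,_) (∈.∈-allFin a)))

  blowUp-unique : Unique vs
  blowUp-unique = Unique.concat⁺
    (All.map⁺ (All.universal (λ i → Unique.map⁺ (λ { refl → refl }) (Unique.allFin⁺ (suc (m i)))) (allFin n)))
    (AllPairs.map⁺ (AllPairs.map disjoint (Unique.allFin⁺ n)))
    where
    disjoint : ∀ {i j} → i ≢ j → ∀ {x} →
      ¬ (x ∈ map (i ,_) (allFin (suc (m i))) × x ∈ map (j ,_) (allFin (suc (m j))))
    disjoint {i} {j} i≢j (x∈ , x∈′) with ∈.∈-map⁻ (i ,_) x∈ | ∈.∈-map⁻ (j ,_) x∈′
    ... | _ , _ , refl | _ , _ , eq = i≢j (cong proj₁ eq)

  blowUp-adj-sym : ∀ u v → T (adj u v) → T (adj v u)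
  blowUp-adj-sym (i , a) (j , b) t with i Fin.≟ j | j Fin.≟ i
  ... | yes refl | yes refl = Paths.adj-sym (H i) t
  ... | yes refl | no i≢i   = ⊥-elim (i≢i refl)
  ... | no i≢i   | yes refl = ⊥-elim (i≢i refl)
  ... | no _     | no _     = Paths.adj-sym G t

  blowUp-adj-across : ∀ u v → Adj G (proj₁ u) (proj₁ v) → T (adj u v)
  blowUp-adj-across (i , a) (j , b) e with i Fin.≟ j
  ... | yes refl = ⊥-elim (Paths.¬adj-refl G e)
  ... | no _     = e

  blowUp-adj-classes : ∀ u v → T (adj u v) → proj₁ u ≡ proj₁ v ⊎ Adj G (proj₁ u) (proj₁ v)
  blowUp-adj-classes (i , a) (j , b) t with i Fin.≟ j
  ... | yes refl = inj₁ refl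
  ... | no _     = inj₂ t

mainTheorem1 : (n : ℕ) (G : Graph n) → IsTree G → DiameterAtLeast3 G →
    (m : Fin n → ℕ) (H : (i : Fin n) → Graph (suc (m i))) →
    ¬ BetweennessUniform (blowUp G m H)
mainTheorem1 n G (connected , acyclic) diam m H uniform =
  let P , p , 4≤ , h , h′ = Paths.leaf-to-leaf-path G acyclic connected diam
  in Uniform.¬leaf-to-leaf-path (B x₀) (λ x → uniform x x₀)
       -- The representatives of the classes on the path are distinct, so the blow-up has at least
       -- four vertices.
       (ℕ.≤-trans (ℕ.n≤1+n 3) (ℕ.≤-trans 4≤ (path-length≤ p))) acyclic P p 4≤ h h′
  where
  x₀ : BV G m H
  x₀ = proj₁ diam , zero
  open Betweenness (blowUp G m H) using (B)
  open BlowUpCentrality (blowUp G m H) G proj₁ (_, zero) (λ _ → refl)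
    (blowUp-complete G m H) (blowUp-unique G m H) (blowUp-adj-sym G m H)
    (blowUp-adj-across G m H) (blowUp-adj-classes G m H)
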